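{- There exists a function $f$ such that for every $\epsilon>0$, every graph $G$ with $\mathrm{mad}(G)<3-\epsilon$ and $\Delta(G)\geq f(\epsilon)$ satisfies $\chi^i_\ell(G)=\Delta(G)$.
   Context: All graphs are finite and simple. $\Delta(G)$ is the maximum degree of $G$. The maximum average degree $\mathrm{mad}(G)$ is the maximum of $\frac{2|E(H)|}{|V(H)|}$ over all subgraphs $H$ of $G$. An injective coloring of $G$ is a (not necessarily proper) coloring of the vertices such that any two distinct vertices with a common neighbor receive different colors. $\chi^i_\ell(G)$ is the smallest integer $k$ such that for every assignment of a list of $k$ colors to each vertex, $G$ has an injective coloring in which every vertex receives a color from its list. -}

module Defs where

open import Data.Nat using (ℕ; zero; suc; _+_; _<_; _≤_; _⊔_)
open import Data.Bool using (Bool; true; false; if_then_else_; _∧_)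
import Data.Rational as Q
open import Data.Fin using (Fin; toℕ)
import Data.Fin as F
open import Data.Integer using (+_)
open import Data.Rational using (ℚ; 0ℚ; _/_)
open import Data.List using (List; length)
open import Data.List.Membership.Propositional using (_∈_)
open import Data.List.Relation.Unary.Unique.Propositional using (Unique)
open import Data.Product using (Σ; _×_; ∃)
open import Relation.Binary.PropositionalEquality using (_≡_; _≢_)
open import Relation.Nullary using (¬_)
open import Relation.Nullary.Decidable using (⌊_⌋)
import Data.Nat as N

record Graph : Set where
  field
    n      : ℕ
    adj    : Fin n → Fin n → Bool
    sym    : ∀ u v → adj u v ≡ adj v u
    irrefl : ∀ v → adj v v ≡ false
open Graph public

card : ∀ {n} → (Fin n → Bool) → ℕ
card {zero}  p = 0
card {suc n} p = (if p F.zero then 1 else 0) + card (λ i → p (F.suc i))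

maxF : ∀ {n} → (Fin n → ℕ) → ℕ
maxF {zero}  f = 0
maxF {suc n} f = f F.zero ⊔ maxF (λ i → f (F.suc i))

degree : (G : Graph) → Fin (n G) → ℕ
degree G v = card (adj G v)

maxDegree : Graph → ℕ
maxDegree G = maxF (degree G)

record Subgraph (G : Graph) : Set where
  field
    vert   : Fin (n G) → Bool
    edge   : Fin (n G) → Fin (n G) → Bool
    esym   : ∀ u v → edge u v ≡ edge v u
    eadj   : ∀ u v → edge u v ≡ true → adj G u v ≡ true
    evertˡ : ∀ u v → edge u v ≡ true → vert u ≡ true
open Subgraph public

nVert : ∀ {G} → Subgraph G → ℕ
nVert H = card (vert H)

sumF : ∀ {n} → (Fin n → ℕ) → ℕ
sumF {zero}  f = 0
sumF {suc n} f = f F.zero + sumF (λ i → f (F.suc i))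

nEdge : ∀ {G} → Subgraph G → ℕ
nEdge H = sumF (λ u → card (λ v → edge H u v ∧ (toℕ u N.<ᵇ toℕ v)))

-- the rational number a / d (only used with d ≥ 1)
ratio : ℕ → ℕ → ℚ
ratio a zero    = 0ℚ
ratio a (suc d) = + a / suc d

avgDeg : ∀ {G} → Subgraph G → ℚ
avgDeg H = ratio (2 N.* nEdge H) (nVert H)

-- mad(G) < r : the maximum of 2|E(H)|/|V(H)| over all (nonempty) subgraphs H
-- is below r, i.e. every nonempty subgraph has average degree below r.
MadBelow : Graph → ℚ → Set
MadBelow G r = (H : Subgraph G) → 1 ≤ nVert H → avgDeg H Q.< r

IsInjective : (G : Graph) → (Fin (n G) → ℕ) → Set
IsInjective G c = ∀ u v w → u ≢ v → adj G u w ≡ true → adj G v w ≡ true → c u ≢ c v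

InjChoosable : Graph → ℕ → Set
InjChoosable G k =
  (L : Fin (n G) → List ℕ) → (∀ v → Unique (L v) × length (L v) ≡ k) →
  Σ (Fin (n G) → ℕ) (λ c → (∀ v → c v ∈ L v) × IsInjective G c)

ListInjChromNumIs : Graph → ℕ → Set
ListInjChromNumIs G k = InjChoosable G k × (∀ j → j < k → ¬ InjChoosable G j)

{-# OPTIONS --safe #-}
module Submission where

-- Let ε ≥ 1/(r+1).  Delete edges one at a time and recolour what the deleted edge constrained.  Call a vertex
-- big if its degree is at least 3(r+1), and let W be the set of 2-vertices without a big neighbour.  Greedy
-- recolouring handles leaves, and edges both of whose ends have fewer than Δ conflicts.  If there are none,
-- discharge: big vertices send almost 1 to each neighbour, and every w in W still has to receive almost 1
-- from a neighbour x or from a big neighbour of such an x, within the capacities of these payers.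
--
-- If all of W can be paid, the average degree is at least 3 - 1/(r+1).  Otherwise alternating paths yield
-- a closed set of saturated payers.  A saturated neighbour x of w has exactly one big neighbour and pays for
-- all but at most one of its other neighbours.  Hence the conflicts through W between the x on whose behalf
-- a big neighbour pays (sinks) and the x that share some w with a sink (sources) form a bipartite graph,
-- and every big vertex involved has many sinks.  Rank sources above sinks around each big vertex and let
-- sources point to the sinks they clash with.  Every induced subgraph of this orientation has a kernel and
-- out-degrees are below the list sizes, so Galvin's argument recolours all sinks and sources at once.

open import Defs renaming (n to order; sym to adj-sym)
open import Data.Nat hiding (_/_)
open import Data.Nat.Properties
open import Data.Nat.Tactic.RingSolver using (solve-∀)
open import Data.Bool using (Bool; true; false; _∧_; T)
import Data.Bool.Properties as Bool
open import Data.Fin using (Fin; zero; suc; toℕ)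
import Data.Fin as F
import Data.Fin.Properties as F
open import Data.List using (List; []; _∷_; length; filter; upTo)
open import Data.List.Properties using (filter-all; filter-accept; filter-reject; length-upTo)
open import Data.List.Membership.Propositional using (_∈_)
open import Data.List.Membership.Propositional.Properties using (∈-filter⁻; ∈-upTo⁻)
open import Data.List.Membership.DecPropositional _≟_ using (_∈?_)
open import Data.List.Relation.Unary.Any using (here)
import Data.List.Relation.Unary.All as All
import Data.List.Relation.Unary.AllPairs as AllPairs
open import Data.List.Relation.Unary.Unique.Propositional using (Unique)
import Data.List.Relation.Unary.Unique.Propositional.Properties as Unique
open import Data.Product
open import Data.Sum using (_⊎_; inj₁; inj₂; [_,_]; [_,_]′)
open import Data.Empty using (⊥; ⊥-elim)
open import Data.Unit using (⊤; tt)
open import Function using (_∘_; id)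
open import Function.Bundles using (Equivalence)
open import Relation.Binary using (tri<; tri≈; tri>)
open import Relation.Binary.PropositionalEquality hiding ([_])
open import Relation.Nullary
open import Relation.Nullary.Decidable using (decidable-stable; dec-true; toSum)

private variable
  m n : ℕ

-- Sums and counting over Fin n

χ : {P : Set} → Dec P → ℕ
χ (yes _) = 1
χ (no _)  = 0

χ-yes : {P : Set} (d : Dec P) → P → χ d ≡ 1
χ-yes (yes _) _ = refl
χ-yes (no ¬p) p = ⊥-elim (¬p p)

χ-no : {P : Set} (d : Dec P) → ¬ P → χ d ≡ 0
χ-no (yes p) ¬p = ⊥-elim (¬p p)
χ-no (no _)  _  = refl

χ≤1 : {P : Set} (d : Dec P) → χ d ≤ 1
χ≤1 (yes _) = ≤-refl
χ≤1 (no _)  = z≤n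

χ-mono : {P Q : Set} (d : Dec P) (d′ : Dec Q) → (P → Q) → χ d ≤ χ d′
χ-mono (yes p) d′ f = ≤-reflexive (sym (χ-yes d′ (f p)))
χ-mono (no _)  d′ f = z≤n

χ-cong : {P Q : Set} (d : Dec P) (d′ : Dec Q) → (P → Q) → (Q → P) → χ d ≡ χ d′
χ-cong d d′ f g = ≤-antisym (χ-mono d d′ f) (χ-mono d′ d g)

χ-disjoint : {P Q R : Set} (d : Dec P) (d′ : Dec Q) (d″ : Dec R) →
             (P → R) → (Q → R) → (P → Q → ⊥) → χ d + χ d′ ≤ χ d″
χ-disjoint (yes p) d′ d″ f g h rewrite χ-no d′ (h p) | χ-yes d″ (f p) = ≤-refl
χ-disjoint (no _)  d′ d″ f g h = χ-mono d′ d″ g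

χ-union : {P Q R : Set} (d : Dec P) (d′ : Dec Q) (d″ : Dec R) → (P → Q ⊎ R) → χ d ≤ χ d′ + χ d″
χ-union (no _)  d′ d″ f = z≤n
χ-union (yes p) d′ d″ f with f p
... | inj₁ q rewrite χ-yes d′ q = s≤s z≤n
... | inj₂ r rewrite χ-yes d″ r = m≤n+m 1 (χ d′)

sumF-cong : {f g : Fin n → ℕ} → (∀ i → f i ≡ g i) → sumF f ≡ sumF g
sumF-cong {zero}  h = refl
sumF-cong {suc n} h = cong₂ _+_ (h zero) (sumF-cong (h ∘ suc))

sumF-mono : {f g : Fin n → ℕ} → (∀ i → f i ≤ g i) → sumF f ≤ sumF g
sumF-mono {zero}  h = z≤n
sumF-mono {suc n} h = +-mono-≤ (h zero) (sumF-mono (h ∘ suc))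

sumF-strict : {f g : Fin n → ℕ} → (∀ i → f i ≤ g i) → ∀ i → f i < g i → sumF f < sumF g
sumF-strict h zero    lt = +-mono-<-≤ lt (sumF-mono (h ∘ suc))
sumF-strict h (suc i) lt = +-mono-≤-< (h zero) (sumF-strict (h ∘ suc) i lt)

sumF-+ : (f g : Fin n → ℕ) → sumF (λ i → f i + g i) ≡ sumF f + sumF g
sumF-+ {zero}  f g = refl
sumF-+ {suc n} f g = begin
  f zero + g zero + sumF (λ i → f (suc i) + g (suc i))       ≡⟨ cong (f zero + g zero +_) (sumF-+ (f ∘ suc) (g ∘ suc)) ⟩
  f zero + g zero + (sumF (f ∘ suc) + sumF (g ∘ suc))        ≡⟨ +-assoc (f zero) (g zero) _ ⟩
  f zero + (g zero + (sumF (f ∘ suc) + sumF (g ∘ suc)))      ≡⟨ cong (f zero +_) (x∙yz≈y∙xz (g zero) (sumF (f ∘ suc)) _) ⟩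
  f zero + (sumF (f ∘ suc) + (g zero + sumF (g ∘ suc)))      ≡⟨ +-assoc (f zero) _ _ ⟨
  f zero + sumF (f ∘ suc) + (g zero + sumF (g ∘ suc))        ∎
  where
  open ≡-Reasoning
  open import Algebra.Properties.CommutativeSemigroup +-commutativeSemigroup using (x∙yz≈y∙xz)

sumF-* : (c : ℕ) (f : Fin n → ℕ) → sumF (λ i → c * f i) ≡ c * sumF f
sumF-* {zero}  c f = sym (*-zeroʳ c)
sumF-* {suc n} c f = trans (cong (c * f zero +_) (sumF-* c (f ∘ suc))) (sym (*-distribˡ-+ c (f zero) _))

sumF-const : (c : ℕ) → sumF {n} (λ _ → c) ≡ n * c
sumF-const {zero}  c = refl
sumF-const {suc n} c = cong (c +_) (sumF-const {n} c)

sumF-0 : sumF {n} (λ _ → 0) ≡ 0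
sumF-0 {n} = trans (sumF-const {n} 0) (*-zeroʳ n)

sumF-swap : (f : Fin m → Fin n → ℕ) →
            sumF (λ i → sumF (f i)) ≡ sumF (λ j → sumF (λ i → f i j))
sumF-swap {zero}  {n} f = sym (sumF-0 {n})
sumF-swap {suc m} {n} f = trans (cong (sumF (f zero) +_) (sumF-swap (f ∘ suc)))
                            (sym (sumF-+ (f zero) (λ j → sumF (λ i → f (suc i) j))))

term≤sumF : (f : Fin n → ℕ) (i : Fin n) → f i ≤ sumF f
term≤sumF f zero    = m≤m+n _ _
term≤sumF f (suc i) = ≤-trans (term≤sumF (f ∘ suc) i) (m≤n+m _ _)

# : {P : Fin n → Set} → (∀ i → Dec (P i)) → ℕ
# P? = sumF (λ i → χ (P? i))

card≡# : (p : Fin n → Bool) → card p ≡ # (λ i → p i Bool.≟ true)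
card≡# {zero}  p = refl
card≡# {suc n} p with p zero
... | true  = cong suc (card≡# (p ∘ suc))
... | false = card≡# (p ∘ suc)

module _ {P Q : Fin n → Set} (P? : ∀ i → Dec (P i)) (Q? : ∀ i → Dec (Q i)) where

  #-mono : (∀ i → P i → Q i) → # P? ≤ # Q?
  #-mono h = sumF-mono (λ i → χ-mono (P? i) (Q? i) (h i))

  #-cong : (∀ i → P i → Q i) → (∀ i → Q i → P i) → # P? ≡ # Q?
  #-cong h h′ = sumF-cong (λ i → χ-cong (P? i) (Q? i) (h i) (h′ i))

#-none : {P : Fin n → Set} (P? : ∀ i → Dec (P i)) → (∀ i → ¬ P i) → # P? ≡ 0
#-none {n} P? h = trans (sumF-cong (λ i → χ-no (P? i) (h i))) (sumF-0 {n})

#≤n : {P : Fin n → Set} (P? : ∀ i → Dec (P i)) → # P? ≤ n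
#≤n {n} P? = ≤-trans (sumF-mono (χ≤1 ∘ P?)) (≤-reflexive (trans (sumF-const {n} 1) (*-identityʳ n)))

#-pos : {P : Fin n → Set} (P? : ∀ i → Dec (P i)) (i : Fin n) → P i → 1 ≤ # P?
#-pos P? i p = ≤-trans (≤-reflexive (sym (χ-yes (P? i) p))) (term≤sumF (χ ∘ P?) i)

#-witness : {P : Fin n → Set} (P? : ∀ i → Dec (P i)) → 1 ≤ # P? → ∃ P
#-witness P? h with F.any? P?
... | yes w = w
... | no ¬w = ⊥-elim (<⇒≢ h (sym (#-none P? (λ i p → ¬w (i , p)))))

#-singleton : (j : Fin n) → # (λ i → i F.≟ j) ≡ 1
#-singleton {suc n} zero = cong suc (#-none {n} (λ i → suc i F.≟ zero) (λ _ ()))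
#-singleton {suc n} (suc j) = trans (cong (_+ # (λ i → suc i F.≟ suc j)) (χ-no (zero {n} F.≟ suc j) (λ ())))
  (trans (#-cong (λ i → suc i F.≟ suc j) (λ i → i F.≟ j) (λ i → F.suc-injective) (λ i → cong suc)) (#-singleton j))

#-singleton′ : (j : Fin n) → # (λ i → j F.≟ i) ≡ 1
#-singleton′ j = trans (#-cong (λ i → j F.≟ i) (λ i → i F.≟ j) (λ i → sym) (λ i → sym)) (#-singleton j)

#-unique : {P : Fin n → Set} (P? : ∀ i → Dec (P i)) → (∀ i j → P i → P j → i ≡ j) → # P? ≤ 1
#-unique P? u with F.any? P?
... | no ¬w = ≤-trans (≤-reflexive (#-none P? (λ i p → ¬w (i , p)))) z≤n
... | yes (i , p) = ≤-trans (#-mono P? (λ j → j F.≟ i) (λ j q → u j i q p)) (≤-reflexive (#-singleton i))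

#-strict : {P Q : Fin n → Set} (P? : ∀ i → Dec (P i)) (Q? : ∀ i → Dec (Q i)) →
           (∀ i → P i → Q i) → (i : Fin n) → Q i → ¬ P i → # P? < # Q?
#-strict {P = P} {Q} P? Q? h i q ¬p = begin-strict
  # P?                                <⟨ n<1+n (# P?) ⟩
  1 + # P?                            ≡⟨ cong (_+ # P?) (#-singleton i) ⟨
  # (λ j → j F.≟ i) + # P?            ≡⟨ sumF-+ (λ j → χ (j F.≟ i)) (χ ∘ P?) ⟨
  sumF (λ j → χ (j F.≟ i) + χ (P? j)) ≤⟨ sumF-mono (λ j → χ-disjoint (j F.≟ i) (P? j) (Q? j) (λ { refl → q }) (h j) (λ { refl → ¬p })) ⟩
  # Q?                                ∎
  where open ≤-Reasoning

-- Both sides count the pairs (i , h i).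
#-fibres : {P : Fin m → Set} (P? : ∀ i → Dec (P i)) (h : Fin m → Fin n) →
           sumF (λ j → # (λ i → P? i ×-dec (h i F.≟ j))) ≡ # P?
#-fibres P? h = trans (sym (sumF-swap (λ i j → χ (P? i ×-dec (h i F.≟ j))))) (sumF-cong fibre)
  where
  fibre : ∀ i → # (λ j → P? i ×-dec (h i F.≟ j)) ≡ χ (P? i)
  fibre i = aux (P? i)
    where
    aux : ∀ d → # (λ j → d ×-dec (h i F.≟ j)) ≡ χ d
    aux d@(yes p) = trans (#-cong (λ j → d ×-dec (h i F.≟ j)) (λ j → h i F.≟ j) (λ j → proj₂) (λ j e → p , e)) (#-singleton′ (h i))
    aux d@(no ¬p) = #-none (λ j → d ×-dec (h i F.≟ j)) (λ j → ¬p ∘ proj₁)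

#-injective : {P : Fin m → Set} (P? : ∀ i → Dec (P i)) {Q : Fin n → Set} (Q? : ∀ j → Dec (Q j)) (h : Fin m → Fin n) →
              (∀ i → P i → Q (h i)) → (∀ i i′ → P i → P i′ → h i ≡ h i′ → i ≡ i′) → # P? ≤ # Q?
#-injective P? Q? h into inj = ≤-trans (≤-reflexive (sym (#-fibres P? h))) (sumF-mono fibre)
  where
  fibre : ∀ j → # (λ i → P? i ×-dec (h i F.≟ j)) ≤ χ (Q? j)
  fibre j with Q? j
  ... | yes _ = #-unique (λ i → P? i ×-dec (h i F.≟ j)) (λ { i i′ (p , e) (p′ , e′) → inj i i′ p p′ (trans e (sym e′)) })
  ... | no ¬q = ≤-reflexive (#-none (λ i → P? i ×-dec (h i F.≟ j)) (λ { i (p , refl) → ¬q (into i p) }))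

#-union≤ : {P : Fin m → Set} (P? : ∀ i → Dec (P i)) {Q : Fin m → Fin n → Set} (Q? : ∀ i j → Dec (Q i j)) →
           # (λ j → F.any? (λ i → P? i ×-dec Q? i j)) ≤ sumF (λ i → χ (P? i) * # (Q? i))
#-union≤ P? Q? = ≤-trans (sumF-mono pointwise) (≤-reflexive (trans (sumF-swap (λ j i → χ (P? i) * χ (Q? i j)))
                   (sumF-cong (λ i → sumF-* (χ (P? i)) (χ ∘ Q? i)))))
  where
  pointwise : ∀ j → χ (F.any? (λ i → P? i ×-dec Q? i j)) ≤ sumF (λ i → χ (P? i) * χ (Q? i j))
  pointwise j with F.any? (λ i → P? i ×-dec Q? i j)
  ... | no _ = z≤n
  ... | yes (i , p , q) = ≤-trans (≤-reflexive (sym (cong₂ _*_ (χ-yes (P? i) p) (χ-yes (Q? i j) q)))) (term≤sumF (λ i → χ (P? i) * χ (Q? i j)) i)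

#-disjoint : {P Q T : Fin n → Set} (P? : ∀ i → Dec (P i)) (Q? : ∀ i → Dec (Q i)) (T? : ∀ i → Dec (T i)) →
             (∀ i → P i → T i) → (∀ i → Q i → T i) → (∀ i → P i → Q i → ⊥) → # P? + # Q? ≤ # T?
#-disjoint P? Q? T? p⇒t q⇒t ¬pq = ≤-trans (≤-reflexive (sym (sumF-+ (χ ∘ P?) (χ ∘ Q?))))
  (sumF-mono (λ i → χ-disjoint (P? i) (Q? i) (T? i) (p⇒t i) (q⇒t i) (¬pq i)))

#-remove : {P : Fin n → Set} (P? : ∀ i → Dec (P i)) (i : Fin n) → P i → suc (# (λ j → P? j ×-dec ¬? (j F.≟ i))) ≤ # P?
#-remove P? i p = #-strict (λ j → P? j ×-dec ¬? (j F.≟ i)) P? (λ _ → proj₁) i p (λ q → proj₂ q refl)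

#≤1⇒≡ : {P : Fin n → Set} (P? : ∀ i → Dec (P i)) → # P? ≤ 1 → ∀ {i j} → P i → P j → i ≡ j
#≤1⇒≡ P? small {i} {j} p q = decidable-stable (i F.≟ j) λ i≢j →
  <⇒≱ (≤-trans (s≤s (#-pos (λ k → P? k ×-dec ¬? (k F.≟ i)) j (q , i≢j ∘ sym))) (#-remove P? i p)) small

#≤2⇒≡ : {P : Fin n → Set} (P? : ∀ i → Dec (P i)) → # P? ≤ 2 → ∀ {i j l} → P i → P j → P l → j ≢ i → l ≢ i → j ≡ l
#≤2⇒≡ P? small {i} p q r j≢i l≢i =
  #≤1⇒≡ (λ k → P? k ×-dec ¬? (k F.≟ i)) (≤-pred (≤-trans (#-remove P? i p) small)) (q , j≢i) (r , l≢i)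

-- Lists of colours

_∖_ : List ℕ → ℕ → List ℕ
xs ∖ c = filter (λ x → ¬? (x ≟ c)) xs

∈-∖⁻ : ∀ {x c} xs → x ∈ xs ∖ c → x ∈ xs × x ≢ c
∈-∖⁻ {c = c} xs = ∈-filter⁻ (λ x → ¬? (x ≟ c)) {xs = xs}

∖-unique : ∀ {xs} c → Unique xs → Unique (xs ∖ c)
∖-unique c = Unique.filter⁺ (λ x → ¬? (x ≟ c))

length-∖-∉ : ∀ {xs c} → ¬ c ∈ xs → length (xs ∖ c) ≡ length xs
length-∖-∉ {c = c} c∉ = cong length (filter-all (λ x → ¬? (x ≟ c)) (All.tabulate λ { x∈ refl → c∉ x∈ }))

length-∖ : ∀ {xs} c → Unique xs → length xs ≤ suc (length (xs ∖ c))
length-∖ {[]}     c u = z≤n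
length-∖ {x ∷ xs} c (x∉ AllPairs.∷ u) with x ≟ c
... | yes refl rewrite filter-reject (λ y → ¬? (y ≟ c)) {x = c} {xs} (λ ¬e → ¬e refl) =
  s≤s (≤-reflexive (sym (length-∖-∉ (λ c∈ → All.lookup x∉ c∈ refl))))
... | no x≢c rewrite filter-accept (λ y → ¬? (y ≟ c)) {x = x} {xs} x≢c = s≤s (length-∖ c u)

available : {P : Fin n → Set} → (∀ i → Dec (P i)) → (Fin n → ℕ) → List ℕ → List ℕ
available {zero}  P? c xs = xs
available {suc n} P? c xs with P? zero
... | yes _ = available (P? ∘ suc) (c ∘ suc) xs ∖ c zero
... | no _  = available (P? ∘ suc) (c ∘ suc) xs

module _ (xs : List ℕ) where

  available-unique : {P : Fin n → Set} (P? : ∀ i → Dec (P i)) (c : Fin n → ℕ) →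
                     Unique xs → Unique (available P? c xs)
  available-unique {zero}  P? c u = u
  available-unique {suc n} P? c u with P? zero
  ... | yes _ = ∖-unique (c zero) (available-unique (P? ∘ suc) (c ∘ suc) u)
  ... | no _  = available-unique (P? ∘ suc) (c ∘ suc) u

  available⁻ : {P : Fin n → Set} (P? : ∀ i → Dec (P i)) (c : Fin n → ℕ) → ∀ {x} →
               x ∈ available P? c xs → x ∈ xs × (∀ i → P i → x ≢ c i)
  available⁻ {zero}  P? c x∈ = x∈ , λ ()
  available⁻ {suc n} P? c x∈ with P? zero
  ... | yes _ = let x∈′ , x≢ = ∈-∖⁻ (available (P? ∘ suc) (c ∘ suc) xs) x∈
                    x∈xs , h = available⁻ (P? ∘ suc) (c ∘ suc) x∈′
                in x∈xs , λ { zero _ → x≢ ; (suc i) → h i }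
  ... | no ¬p = let x∈xs , h = available⁻ (P? ∘ suc) (c ∘ suc) x∈
                in x∈xs , λ { zero p → ⊥-elim (¬p p) ; (suc i) → h i }

  -- Each forbidden index costs at most one colour, because the list has no repetitions.
  length-available : {P : Fin n → Set} (P? : ∀ i → Dec (P i)) (c : Fin n → ℕ) →
                     Unique xs → length xs ≤ # P? + length (available P? c xs)
  length-available {zero}  P? c u = ≤-refl
  length-available {suc n} P? c u with P? zero
  ... | no _  = length-available (P? ∘ suc) (c ∘ suc) u
  ... | yes _ = begin
    length xs                                ≤⟨ length-available (P? ∘ suc) (c ∘ suc) u ⟩
    # (P? ∘ suc) + length ys                 ≤⟨ +-monoʳ-≤ (# (P? ∘ suc)) (length-∖ (c zero) (available-unique (P? ∘ suc) (c ∘ suc) u)) ⟩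
    # (P? ∘ suc) + suc (length (ys ∖ c zero)) ≡⟨ +-suc (# (P? ∘ suc)) _ ⟩
    suc (# (P? ∘ suc) + length (ys ∖ c zero)) ∎
    where
    open ≤-Reasoning
    ys = available (P? ∘ suc) (c ∘ suc) xs

nonempty : (xs : List ℕ) → 1 ≤ length xs → ∃ (_∈ xs)
nonempty (x ∷ _) _ = x , here refl

-- Kernels and list colourings

module Kernel (place : Fin n → Fin n) (rank : Fin n → ℕ)
              {Sink : Fin n → Set} (sink? : ∀ a → Dec (Sink a))
              {Clash : Fin n → Fin n → Set} (clash? : ∀ a b → Dec (Clash a b)) where

  -- Read `Above a b` as: b lies above a at their common place. A smaller `rank` is higher, and
  -- elements point upwards.
  Above : Fin n → Fin n → Set
  Above a b = place a ≡ place b × rank b < rank a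

  Out : Fin n → Fin n → Set
  Out a b = Above a b ⊎ (¬ Sink a × Sink b × Clash a b)

  abstract
    above? : ∀ a b → Dec (Above a b)
    above? a b = (place a F.≟ place b) ×-dec (rank b <? rank a)

  abstract
    out? : ∀ a b → Dec (Out a b)
    out? a b = above? a b ⊎-dec (¬? (sink? a) ×-dec sink? b ×-dec clash? a b)

  record IsKernel (A K : Fin n → Set) : Set where
    field
      subset      : ∀ a → K a → A a
      independent : ∀ a b → K a → K b → ¬ Out a b
      absorbing   : ∀ a → A a → ¬ K a → ∃ λ b → K b × Out a b
  open IsKernel

  Top : (Fin n → Set) → Fin n → Set
  Top A a = A a × ¬ ∃ λ b → A b × Above a b

  abstract
    top? : ∀ {A} → (∀ a → Dec (A a)) → ∀ a → Dec (Top A a)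
    top? A? a = A? a ×-dec ¬? (F.any? λ b → A? b ×-dec above? a b)

  -- Going up strictly lowers `rank`, so `r` bounds the climb, and it ends at a top element.
  top-above : ∀ {A} (A? : ∀ a → Dec (A a)) r a → rank a < r → A a → ¬ Top A a → ∃ λ b → Top A b × Above a b
  top-above A? (suc r) a (s≤s a≤r) Aa ¬top with F.any? (λ b → A? b ×-dec above? a b)
  ... | no ¬b = ⊥-elim (¬top (Aa , ¬b))
  ... | yes (b , Ab , ab@(pl , rk)) with top? A? b
  ...   | yes tb = b , tb , ab
  ...   | no ¬tb = let c , tc , (pl′ , rk′) = top-above A? r b (<-≤-trans rk a≤r) Ab ¬tb
                   in c , tc , (trans pl pl′ , <-trans rk′ rk)

  Kernel : (Fin n → Set) → Set₁
  Kernel A = Σ (Fin n → Set) λ K → (∀ a → Dec (K a)) × IsKernel A K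

  Bad : (Fin n → Set) → Fin n → Fin n → Set
  Bad A s z = Top A s × Top A z × ¬ Sink s × Sink z × Clash s z

  abstract
    bad? : ∀ {A} → (∀ a → Dec (A a)) → ∀ s z → Dec (Bad A s z)
    bad? A? s z = top? A? s ×-dec top? A? z ×-dec ¬? (sink? s) ×-dec sink? z ×-dec clash? s z

  -- No upward arc joins two top elements, so only arcs from sources to sinks could spoil
  -- independence. Climbing gives absorption.
  top-kernel : ∀ {A} (A? : ∀ a → Dec (A a)) → (∀ s z → ¬ Bad A s z) → IsKernel A (Top A)
  top-kernel A? ¬bad .subset _ = proj₁
  top-kernel A? ¬bad .independent a b ta tb (inj₁ ab) = proj₂ ta (b , proj₁ tb , ab)
  top-kernel A? ¬bad .independent a b ta tb (inj₂ (¬sa , sb , ab)) = ¬bad a b (ta , tb , ¬sa , sb , ab)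
  top-kernel A? ¬bad .absorbing a Aa ¬ta =
    let b , tb , ab = top-above A? (suc (rank a)) a ≤-refl Aa ¬ta in b , tb , inj₁ ab

  -- A top sink z has no out-neighbours, so it lies in every kernel of A − s; such a kernel therefore
  -- also absorbs an s that points to z.
  insert-bad : ∀ {A K s z} → Bad A s z → (∀ a → Dec (K a)) → IsKernel (λ a → A a × a ≢ s) K → IsKernel A K
  insert-bad bad K? isK .subset a Ka = proj₁ (subset isK a Ka)
  insert-bad bad K? isK .independent = independent isK
  insert-bad {A} {K} {s} {z} (_ , (Az , topz) , ¬ss , sz , clash) K? isK .absorbing a Aa ¬Ka with a F.≟ s
  ... | no a≢s   = absorbing isK a (Aa , a≢s) ¬Ka
  ... | yes refl = z , z∈K , inj₂ (¬ss , sz , clash)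
    where
    z∈K : K z
    z∈K with K? z
    ... | yes Kz = Kz
    ... | no ¬Kz with absorbing isK z (Az , λ { refl → ¬ss sz }) ¬Kz
    ...   | b , Kb , inj₁ zb = ⊥-elim (topz (b , proj₁ (subset isK b Kb) , zb))
    ...   | b , Kb , inj₂ (¬sz , _) = ⊥-elim (¬sz sz)

  -- A form of deferred acceptance: as long as a top source points to a top sink, that source is
  -- discarded, and `insert-bad` returns it to the set afterwards.
  kernel : ∀ m {A : Fin n → Set} (A? : ∀ a → Dec (A a)) → # A? ≤ m → Kernel A
  kernel-step : ∀ m {A : Fin n → Set} (A? : ∀ a → Dec (A a)) → # A? ≤ m → Dec (∃₂ (Bad A)) → Kernel A

  kernel m A? size = kernel-step m A? size (F.any? λ s → F.any? λ z → bad? A? s z)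

  kernel-step m       {A} A? size (no ¬bad) = Top A , top? A? , top-kernel A? (λ s z b → ¬bad (s , z , b))
  kernel-step zero    A? size (yes (s , _ , (As , _) , _)) = ⊥-elim (<⇒≱ (#-pos A? s As) size)
  kernel-step (suc m) {A} A? size (yes (s , z , bad)) =
    let K , K? , isK = kernel m A′? (≤-pred (<-≤-trans smaller size)) in K , K? , insert-bad bad K? isK
    where
    A′? : ∀ a → Dec (A a × a ≢ s)
    A′? a = A? a ×-dec ¬? (a F.≟ s)
    smaller : # A′? < # A?
    smaller = #-strict A′? A? (λ _ → proj₁) s (proj₁ (proj₁ bad)) (λ p → proj₂ p refl)

  Colouring : (Fin n → Set) → (Fin n → List ℕ) → Set
  Colouring S L = Σ (Fin n → ℕ) λ c → (∀ a → S a → c a ∈ L a) × (∀ a b → S a → S b → Out a b → c a ≢ c b)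

  outdegree : {S : Fin n → Set} → (∀ a → Dec (S a)) → Fin n → ℕ
  outdegree S? a = # (λ b → S? b ×-dec out? a b)

  module _ {S K : Fin n → Set} (S? : ∀ a → Dec (S a)) (K? : ∀ a → Dec (K a))
           (L : Fin n → List ℕ) (x : ℕ) (isK : IsKernel (λ a → S a × x ∈ L a) K) where

    Rest : Fin n → Set
    Rest a = S a × ¬ K a

    rest? : ∀ a → Dec (Rest a)
    rest? a = S? a ×-dec ¬? (K? a)

    rest-smaller : ∀ {b} → K b → # rest? < # S?
    rest-smaller {b} Kb = #-strict rest? S? (λ _ → proj₁) b (proj₁ (subset isK b Kb)) (λ p → proj₂ p Kb)

    -- An element of Rest that loses the colour x also loses an out-neighbour.
    rest-enough : (∀ a → Unique (L a)) → (∀ a → S a → outdegree S? a < length (L a)) →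
                  ∀ a → Rest a → outdegree rest? a < length (L a ∖ x)
    rest-enough uniq enough a (Sa , ¬Ka) with x ∈? L a
    ... | no x∉ = <-≤-trans (≤-<-trans (#-mono (λ b → rest? b ×-dec out? a b) (λ b → S? b ×-dec out? a b) (λ _ → map₁ proj₁)) (enough a Sa))
                    (≤-reflexive (sym (length-∖-∉ x∉)))
    ... | yes x∈ = let b , Kb , o = absorbing isK a (Sa , x∈) ¬Ka in
      ≤-pred (≤-trans (s≤s (#-strict (λ b → rest? b ×-dec out? a b) (λ b → S? b ×-dec out? a b) (λ _ → map₁ proj₁)
                              b (proj₁ (subset isK b Kb) , o) (λ p → proj₂ (proj₁ p) Kb)))
               (≤-trans (enough a Sa) (length-∖ x (uniq a))))

    -- All of `K` may receive `x`: it is independent, and `x` has been removed from the lists of the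
    -- others.
    colour-kernel : Colouring Rest (λ a → L a ∖ x) → Colouring S L
    colour-kernel (c′ , c′∈ , c′≢) = c , c∈ , c≢
      where
      c : Fin n → ℕ
      c a with K? a
      ... | yes _ = x
      ... | no _  = c′ a
      c∈ : ∀ a → S a → c a ∈ L a
      c∈ a Sa with K? a
      ... | yes Ka = proj₂ (subset isK a Ka)
      ... | no ¬Ka = proj₁ (∈-∖⁻ (L a) (c′∈ a (Sa , ¬Ka)))
      c≢ : ∀ a b → S a → S b → Out a b → c a ≢ c b
      c≢ a b Sa Sb o with K? a | K? b
      ... | yes Ka | yes Kb = ⊥-elim (independent isK a b Ka Kb o)
      ... | yes Ka | no ¬Kb = λ e → proj₂ (∈-∖⁻ (L b) (c′∈ b (Sb , ¬Kb))) (sym e)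
      ... | no ¬Ka | yes Kb = proj₂ (∈-∖⁻ (L a) (c′∈ a (Sa , ¬Ka)))
      ... | no ¬Ka | no ¬Kb = c′≢ a b (Sa , ¬Ka) (Sb , ¬Kb) o

  -- Galvin's argument: give one colour to a kernel of the elements that still have it in their lists.
  list-colouring : ∀ m {S : Fin n → Set} (S? : ∀ a → Dec (S a)) → # S? ≤ m → (L : Fin n → List ℕ) → (∀ a → Unique (L a)) →
                   (∀ a → S a → outdegree S? a < length (L a)) → Colouring S L
  galvin-step : ∀ m {S : Fin n → Set} (S? : ∀ a → Dec (S a)) → # S? ≤ m → (L : Fin n → List ℕ) → (∀ a → Unique (L a)) →
                (∀ a → S a → outdegree S? a < length (L a)) → Dec (∃ S) → Colouring S L

  list-colouring m S? size L uniq enough = galvin-step m S? size L uniq enough (F.any? S?)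

  galvin-step m       S? size L uniq enough (no ¬S) = (λ _ → 0) , (λ a Sa → ⊥-elim (¬S (a , Sa))) , (λ a b Sa → ⊥-elim (¬S (a , Sa)))
  galvin-step zero    S? size L uniq enough (yes (s , Ss)) = ⊥-elim (<⇒≱ (#-pos S? s Ss) size)
  galvin-step (suc m) {S} S? size L uniq enough (yes (s , Ss)) with nonempty (L s) (≤-trans (s≤s z≤n) (enough s Ss))
  ... | x , x∈s with kernel n {λ a → S a × x ∈ L a} (λ a → S? a ×-dec (x ∈? L a)) (#≤n (λ a → S? a ×-dec (x ∈? L a)))
  ...   | K , K? , isK = colour-kernel S? K? L x isK
          (list-colouring m (rest? S? K? L x isK) (≤-pred (<-≤-trans (rest-smaller S? K? L x isK (proj₂ (someK (K? s)))) size))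
            (λ a → L a ∖ x) (λ a → ∖-unique x (uniq a)) (rest-enough S? K? L x isK uniq enough))
    where
    -- The recursion shrinks because `K` has an element: `s` itself or one that absorbs it.
    someK : Dec (K s) → ∃ K
    someK (yes Ks) = s , Ks
    someK (no ¬Ks) = let b , Kb , _ = absorbing isK s (Ss , x∈s) ¬Ks in b , Kb

-- Assignments with capacities

module Assignment {W : Fin n → Set} (W? : ∀ w → Dec (W w))
                  {A : Fin n → Fin n → Set} (A? : ∀ w p → Dec (A w p))
                  (cap : Fin n → ℕ) where

  Assign : Set
  Assign = Fin n → Fin n

  Valid : Assign → Set
  Valid f = ∀ w → W w → A w (f w)

  load : Assign → Fin n → ℕ
  load f p = # (λ w → W? w ×-dec (f w F.≟ p))

  excess : Assign → ℕ
  excess f = sumF (λ p → load f p ∸ cap p)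

  -- Relievable f t p: p is joined to a payer with spare capacity by an alternating path of length at most t.
  Relievable : Assign → ℕ → Fin n → Set
  Relievable f zero    p = load f p < cap p
  Relievable f (suc t) p = Relievable f t p ⊎ ∃ λ w → W w × f w ≡ p × ∃ λ p′ → A w p′ × Relievable f t p′

  relievable? : ∀ f t p → Dec (Relievable f t p)
  relievable? f zero    p = load f p <? cap p
  relievable? f (suc t) p = relievable? f t p ⊎-dec
    F.any? λ w → W? w ×-dec (f w F.≟ p) ×-dec F.any? λ p′ → A? w p′ ×-dec relievable? f t p′

  relievable-mono : ∀ f {s t} → s ≤′ t → ∀ p → Relievable f s p → Relievable f t p
  relievable-mono f ≤′-refl     p r = r
  relievable-mono f (≤′-step h) p r = inj₁ (relievable-mono f h p r)

  module Shift (f : Assign) (valid : Valid f) {w p′ : Fin n} (Ww : W w) (Awp′ : A w p′) where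

    p : Fin n
    p = f w

    g : Assign
    g v with v F.≟ w
    ... | yes _ = p′
    ... | no _  = f v

    g-other : ∀ {v} → v ≢ w → g v ≡ f v
    g-other {v} v≢w with v F.≟ w
    ... | yes e = ⊥-elim (v≢w e)
    ... | no _  = refl

    g-valid : Valid g
    g-valid v Wv with v F.≟ w
    ... | yes refl = Awp′
    ... | no _     = valid v Wv

    -- The additive form avoids truncated subtraction and holds for `p ≡ p′` too.
    g-load : ∀ x → load g x + χ (p F.≟ x) ≡ load f x + χ (p′ F.≟ x)
    g-load x = begin
      load g x + χ (p F.≟ x)     ≡⟨ cong (load g x +_) (at-w (χ (p F.≟ x))) ⟩
      load g x + sumF (λ v → χ (p F.≟ x) * χ (v F.≟ w))  ≡⟨ sumF-+ (λ v → χ (W? v ×-dec (g v F.≟ x))) (λ v → χ (p F.≟ x) * χ (v F.≟ w)) ⟨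
      sumF (λ v → χ (W? v ×-dec (g v F.≟ x)) + χ (p F.≟ x) * χ (v F.≟ w)) ≡⟨ sumF-cong pointwise ⟩
      sumF (λ v → χ (W? v ×-dec (f v F.≟ x)) + χ (p′ F.≟ x) * χ (v F.≟ w)) ≡⟨ sumF-+ (λ v → χ (W? v ×-dec (f v F.≟ x))) (λ v → χ (p′ F.≟ x) * χ (v F.≟ w)) ⟩
      load f x + sumF (λ v → χ (p′ F.≟ x) * χ (v F.≟ w)) ≡⟨ cong (load f x +_) (at-w (χ (p′ F.≟ x))) ⟨
      load f x + χ (p′ F.≟ x)    ∎
      where
      open ≡-Reasoning
      at-w : ∀ c → c ≡ sumF (λ v → c * χ (v F.≟ w))
      at-w c = sym (trans (sumF-* c (λ v → χ (v F.≟ w))) (trans (cong (c *_) (#-singleton w)) (*-identityʳ c)))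
      pointwise : ∀ v → χ (W? v ×-dec (g v F.≟ x)) + χ (p F.≟ x) * χ (v F.≟ w) ≡ χ (W? v ×-dec (f v F.≟ x)) + χ (p′ F.≟ x) * χ (v F.≟ w)
      pointwise v with v F.≟ w
      ... | no _ = cong (χ (W? v ×-dec (f v F.≟ x)) +_) (trans (*-zeroʳ (χ (p F.≟ x))) (sym (*-zeroʳ (χ (p′ F.≟ x)))))
      ... | yes refl = begin
        χ (W? w ×-dec (p′ F.≟ x)) + χ (p F.≟ x) * 1  ≡⟨ cong₂ _+_ (χ-cong (W? w ×-dec (p′ F.≟ x)) (p′ F.≟ x) proj₂ (Ww ,_)) (*-identityʳ _) ⟩
        χ (p′ F.≟ x) + χ (p F.≟ x)                   ≡⟨ +-comm (χ (p′ F.≟ x)) _ ⟩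
        χ (p F.≟ x) + χ (p′ F.≟ x)                   ≡⟨ cong₂ _+_ (χ-cong (W? w ×-dec (p F.≟ x)) (p F.≟ x) proj₂ (Ww ,_)) (*-identityʳ _) ⟨
        χ (W? w ×-dec (p F.≟ x)) + χ (p′ F.≟ x) * 1  ∎

    module _ (p≢p′ : p ≢ p′) where

      load-p : load f p ≡ suc (load g p)
      load-p = trans (sym (+-identityʳ _)) (trans (cong (load f p +_) (sym (χ-no (p′ F.≟ p) (p≢p′ ∘ sym))))
        (trans (sym (g-load p)) (trans (cong (load g p +_) (χ-yes (p F.≟ p) refl)) (+-comm (load g p) 1))))

      load-p′ : load g p′ ≡ suc (load f p′)
      load-p′ = trans (sym (+-identityʳ _)) (trans (cong (load g p′ +_) (sym (χ-no (p F.≟ p′) p≢p′)))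
        (trans (g-load p′) (trans (cong (load f p′ +_) (χ-yes (p′ F.≟ p′) refl)) (+-comm (load f p′) 1))))

    load-other : ∀ {x} → p ≢ x → p′ ≢ x → load g x ≡ load f x
    load-other {x} p≢x p′≢x = +-cancelʳ-≡ 0 _ _
      (subst₂ (λ i j → load g x + i ≡ load f x + j) (χ-no (p F.≟ x) p≢x) (χ-no (p′ F.≟ x) p′≢x) (g-load x))

    module _ (over : cap p < load f p) (p≢p′ : p ≢ p′) where

      private
        drop : suc (load g p ∸ cap p) ≡ load f p ∸ cap p
        drop = trans (sym (+-∸-assoc 1 (≤-pred (≤-trans over (≤-reflexive (load-p p≢p′)))))) (cong (_∸ cap p) (sym (load-p p≢p′)))

      excess-slack : load f p′ < cap p′ → excess g < excess f
      excess-slack slack = begin-strict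
        excess g                                              <⟨ n<1+n _ ⟩
        1 + excess g                                          ≡⟨ cong (_+ excess g) (#-singleton′ p) ⟨
        # (p F.≟_) + excess g                                 ≡⟨ sumF-+ (λ x → χ (p F.≟ x)) (λ x → load g x ∸ cap x) ⟨
        sumF (λ x → χ (p F.≟ x) + (load g x ∸ cap x))         ≤⟨ sumF-mono pointwise ⟩
        excess f                                              ∎
        where
        open ≤-Reasoning
        pointwise : ∀ x → χ (p F.≟ x) + (load g x ∸ cap x) ≤ load f x ∸ cap x
        pointwise x with p F.≟ x
        ... | yes refl = ≤-reflexive drop
        ... | no p≢x with p′ F.≟ x
        ...   | no p′≢x  = ≤-reflexive (cong (_∸ cap x) (load-other p≢x p′≢x))
        ...   | yes refl = ≤-trans (≤-reflexive (m≤n⇒m∸n≡0 (≤-trans (≤-reflexive (load-p′ p≢p′)) slack))) z≤n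

      -- `p` loses one unit of overload and `p′` gains at most one, so the overload is only passed
      -- along.
      excess-full : excess g ≤ excess f
      excess-full = ≤-pred (begin
        1 + excess g                                          ≡⟨ cong (_+ excess g) (#-singleton′ p) ⟨
        # (p F.≟_) + excess g                                 ≡⟨ sumF-+ (λ x → χ (p F.≟ x)) (λ x → load g x ∸ cap x) ⟨
        sumF (λ x → χ (p F.≟ x) + (load g x ∸ cap x))         ≤⟨ sumF-mono pointwise ⟩
        sumF (λ x → χ (p′ F.≟ x) + (load f x ∸ cap x))        ≡⟨ sumF-+ (λ x → χ (p′ F.≟ x)) (λ x → load f x ∸ cap x) ⟩
        # (p′ F.≟_) + excess f                                ≡⟨ cong (_+ excess f) (#-singleton′ p′) ⟩
        1 + excess f                                          ∎)
        where
        open ≤-Reasoning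
        pointwise : ∀ x → χ (p F.≟ x) + (load g x ∸ cap x) ≤ χ (p′ F.≟ x) + (load f x ∸ cap x)
        pointwise x with p F.≟ x
        ... | yes refl = ≤-trans (≤-reflexive drop) (m≤n+m _ (χ (p′ F.≟ p)))
        ... | no p≢x with p′ F.≟ x
        ...   | no p′≢x  = ≤-reflexive (cong (_∸ cap x) (load-other p≢x p′≢x))
        ...   | yes refl = ≤-trans (≤-reflexive (cong (_∸ cap p′) (load-p′ p≢p′))) (suc-∸≤ (load f p′) (cap p′))
          where
          suc-∸≤ : ∀ a b → suc a ∸ b ≤ suc (a ∸ b)
          suc-∸≤ a zero    = ≤-refl
          suc-∸≤ zero (suc b) = ≤-trans (≤-reflexive (0∸n≡0 b)) z≤n
          suc-∸≤ (suc a) (suc b) = suc-∸≤ a b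

    -- Alternating paths shorter than the one through w avoid p, so they survive the shift.
    relievable-shift : ∀ {t} → ¬ Relievable f t p → ¬ load f p′ < cap p′ →
                       ∀ {s} → s ≤′ t → ∀ x → Relievable f s x → Relievable g s x
    relievable-shift {t} ¬rp ¬slack {zero} s≤t x r =
      subst (_< cap x) (sym (load-other (λ { refl → ¬rp (relievable-mono f s≤t x r) }) (λ { refl → ¬slack r }))) r
    relievable-shift {t} ¬rp ¬slack {suc s} s≤t x (inj₁ r) =
      inj₁ (relievable-shift ¬rp ¬slack (≤⇒≤′ (<⇒≤ (≤′⇒≤ s≤t))) x r)
    relievable-shift {t} ¬rp ¬slack {suc s} s≤t x r@(inj₂ (v , Wv , fv≡x , y , Avy , ry)) =
      inj₂ (v , Wv , trans (g-other (λ { refl → ¬rp (subst (Relievable f t) (sym fv≡x) (relievable-mono f s≤t x r)) })) fv≡x ,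
            y , Avy , relievable-shift ¬rp ¬slack (≤⇒≤′ (<⇒≤ (≤′⇒≤ s≤t))) y ry)

  -- Augmentation along an alternating path. While the next payer is full, a unit of overload moves
  -- on to it without increasing the total; at a payer with spare capacity it vanishes.
  improve : ∀ t f → Valid f → ∀ p → cap p < load f p → Relievable f t p → Σ Assign λ g → Valid g × excess g < excess f
  improve zero f valid p over r = ⊥-elim (<-asym over r)
  -- Shorter paths are tried first, since `relievable-shift` needs that `p` has none of length at
  -- most `t`.
  improve (suc t) f valid p over r with relievable? f t p
  ... | yes r′ = improve t f valid p over r′
  improve (suc t) f valid p over (inj₁ r) | no ¬r = ⊥-elim (¬r r)
  improve (suc t) f valid p over (inj₂ (w , Ww , refl , p′ , Awp′ , r)) | no ¬r with load f p′ <? cap p′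
  ... | yes slack = Shift.g f valid Ww Awp′ , Shift.g-valid f valid Ww Awp′ ,
                    Shift.excess-slack f valid Ww Awp′ over (λ { refl → ¬r r }) slack
  ... | no ¬slack =
    let h , h-valid , lt = improve t g g-valid p′
          (≤-trans (s≤s (≮⇒≥ ¬slack)) (≤-reflexive (sym (load-p′ p≢p′))))
          (relievable-shift ¬r ¬slack ≤′-refl p′ r)
    in h , h-valid , <-≤-trans lt (excess-full over p≢p′)
    where
    open Shift f valid Ww Awp′
    p≢p′ : f w ≢ p′
    p≢p′ refl = ¬r r

  Stationary : Assign → ℕ → Set
  Stationary f t = ∀ p → Relievable f (suc t) p → Relievable f t p

  -- Every step that is not stationary adds a payer, so at least `t` payers are relievable after `t`
  -- such steps, and there are only `n`.
  stationary : ∀ f → ∃ (Stationary f)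
  stationary f = search (suc n) 0 z≤n (λ h → <⇒≱ (n<1+n n) (≤-trans (≤-reflexive (sym (+-identityʳ (suc n)))) h))
    where
    search : ∀ fuel t → t ≤ # (relievable? f t) → ¬ (fuel + t ≤ n) → ∃ (Stationary f)
    search zero t big small = ⊥-elim (small (≤-trans big (#≤n (relievable? f t))))
    search (suc fuel) t big small with F.any? (λ p → relievable? f (suc t) p ×-dec ¬? (relievable? f t p))
    ... | no ¬new = t , λ p r → decidable-stable (relievable? f t p) (λ ¬r → ¬new (p , r , ¬r))
    ... | yes (p , r , ¬r) = search fuel (suc t)
      (≤-trans (s≤s big) (#-strict (relievable? f t) (relievable? f (suc t)) (λ _ → inj₁) p r ¬r))
      (λ h → small (≤-trans (≤-reflexive (sym (+-suc fuel t))) h))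

  Balanced : Set
  Balanced = Σ Assign λ f → Valid f × ∀ p → load f p ≤ cap p

  -- An obstruction of Hall type: the vertices paid from `X` cannot be paid from elsewhere, and
  -- every member of `X` is already full.
  record Saturated : Set₁ where
    field
      f         : Assign
      valid     : Valid f
      X         : Fin n → Set
      X?        : ∀ p → Dec (X p)
      inhabited : ∃ λ w → W w × X (f w)
      closed    : ∀ {w p} → W w → X (f w) → A w p → X p
      saturated : ∀ {p} → X p → cap p ≤ load f p

  optimise : ∀ m f → Valid f → excess f < m → Balanced ⊎ Saturated
  optimise (suc m) f valid (s≤s small) with F.any? (λ p → cap p <? load f p)
  ... | no ¬over = inj₁ (f , valid , λ p → ≮⇒≥ (λ o → ¬over (p , o)))
  ... | yes (p , over) with stationary f
  ...   | t , st with relievable? f t p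
  ...     | yes r = let g , g-valid , lt = improve t f valid p over r in optimise m g g-valid (<-≤-trans lt small)
  ...     | no ¬r = inj₂ (record
    { f = f ; valid = valid ; X = λ x → ¬ Relievable f t x ; X? = λ x → ¬? (relievable? f t x)
    ; inhabited = let w , Ww , e = #-witness (λ w → W? w ×-dec (f w F.≟ p)) (≤-trans (s≤s z≤n) over)
                  in w , Ww , subst (λ x → ¬ Relievable f t x) (sym e) ¬r
    -- If `x` were relievable, the path through `w` would make `f w` relievable with one step more,
    -- and stationarity saves that step.
    ; closed = λ {w} {x} Ww Xfw Awx rx → Xfw (st (f w) (inj₂ (w , Ww , refl , x , Awx , rx)))
    ; saturated = λ {x} ¬rx → ≮⇒≥ (λ l → ¬rx (relievable-mono f (≤⇒≤′ z≤n) x l)) })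

  assignment : (∀ w → W w → ∃ (A w)) → Balanced ⊎ Saturated
  assignment payer = optimise (suc (excess f₀)) f₀ f₀-valid ≤-refl
    where
    f₀ : Assign
    f₀ w with W? w
    ... | yes Ww = proj₁ (payer w Ww)
    ... | no _   = w
    f₀-valid : Valid f₀
    f₀-valid w Ww with W? w
    ... | yes Ww′ = proj₂ (payer w Ww′)
    ... | no ¬Ww  = ⊥-elim (¬Ww Ww)

-- Discharging

-- With charges scaled by r + 1, a big vertex can send r to each neighbour and keep 3r + 2; a huge one can
-- moreover pay r to bigDegree r vertices of W.  A vertex that is not big and has no big neighbour, or only
-- one and that one not huge, has fewer than threshold r conflicts.
bigDegree hugeDegree threshold : ℕ → ℕ
bigDegree r  = 3 * suc r
hugeDegree r = 2 + 3 * r + r * bigDegree r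
threshold r  = hugeDegree r + bigDegree r * bigDegree r

module Edges (e : Fin n → Fin n → Bool) (e-sym : ∀ u v → e u v ≡ e v u) (r : ℕ) where

  Adj : Fin n → Fin n → Set
  Adj u v = e u v ≡ true

  abstract
    adj? : ∀ u v → Dec (Adj u v)
    adj? u v = e u v Bool.≟ true

  Adj-sym : ∀ {u v} → Adj u v → Adj v u
  Adj-sym {u} {v} a = trans (e-sym v u) a

  deg : Fin n → ℕ
  deg u = # (adj? u)

  Conf : Fin n → Fin n → Set
  Conf a b = a ≢ b × ∃ λ m → Adj a m × Adj b m

  abstract
    conf? : ∀ a b → Dec (Conf a b)
    conf? a b = ¬? (a F.≟ b) ×-dec F.any? λ m → adj? a m ×-dec adj? b m

  Conf-sym : ∀ {a b} → Conf a b → Conf b a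
  Conf-sym (a≢b , m , am , bm) = a≢b ∘ sym , m , bm , am

  M H : ℕ
  M = bigDegree r
  H = hugeDegree r

  Big : Fin n → Set
  Big v = M ≤ deg v

  abstract
    big? : ∀ v → Dec (Big v)
    big? v = M ≤? deg v

  bigNbr? : ∀ u v → Dec (Adj u v × Big v)
  bigNbr? u v = adj? u v ×-dec big? v

  bigs : Fin n → ℕ
  bigs u = # (bigNbr? u)

  -- These vertices start with charge 2 (r + 1) and get nothing from big neighbours, so they fall
  -- short of 2 + 3 r by exactly r.
  W : Fin n → Set
  W w = deg w ≡ 2 × bigs w ≡ 0

  abstract
    W? : ∀ w → Dec (W w)
    W? w = (deg w ≟ 2) ×-dec (bigs w ≟ 0)

  W-small : ∀ {w} → W w → ¬ Big w
  W-small (d≡2 , _) big = <⇒≱ (≤-trans (s≤s (≤-reflexive d≡2)) (*-monoʳ-≤ 3 (s≤s z≤n))) big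

  W-nbr-small : ∀ {w x} → W w → Adj w x → ¬ Big x
  W-nbr-small {w} {x} (_ , b≡0) wx big = <⇒≢ (#-pos (bigNbr? w) x (wx , big)) (sym b≡0)

  Pays : Fin n → Fin n → Set
  Pays w p = Adj w p ⊎ (Big p × ∃ λ x → Adj w x × Adj x p)

  abstract
    pays? : ∀ w p → Dec (Pays w p)
    pays? w p = adj? w p ⊎-dec (big? p ×-dec F.any? λ x → adj? w x ×-dec adj? x p)

  -- The capacities are what `charge` can afford, in units of r. A small vertex of degree d ≥ 2 with
  -- b ≥ 1 big neighbours has (r + 1) d + r b ≥ 2 + 3 r + r (d + b - 3), and `hugeDegree` leaves a
  -- huge vertex `r * M` beyond its other duties.
  cap : Fin n → ℕ
  cap p with big? p
  ... | yes _ = χ (H ≤? deg p) * M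
  ... | no _  = χ (1 ≤? bigs p) * (deg p + bigs p ∸ 3)

  open Assignment W? pays? cap public

  small-payer : ∀ {w p} → ¬ Big p → Pays w p → Adj w p
  small-payer ¬big (inj₁ wp)        = wp
  small-payer ¬big (inj₂ (big , _)) = ⊥-elim (¬big big)

  payer : ∀ w → W w → ∃ (Pays w)
  payer w (d≡2 , _) = map₂ inj₁ (#-witness (adj? w) (≤-trans (s≤s z≤n) (≤-reflexive (sym d≡2))))

  NoLeaves : Set
  NoLeaves = ∀ v → deg v ≢ 1

  NonIsolated? : ∀ v → Dec (1 ≤ deg v)
  NonIsolated? v = 1 ≤? deg v

  -- Double counting of the adjacent pairs whose second vertex is big.
  bigs-sum : sumF bigs ≡ sumF (λ v → χ (big? v) * deg v)
  bigs-sum = trans (sumF-swap (λ u v → χ (bigNbr? u v))) (sumF-cong column)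
    where
    column : ∀ v → # (λ u → bigNbr? u v) ≡ χ (big? v) * deg v
    column v with big? v
    ... | yes big = trans (#-cong (λ u → adj? u v ×-dec yes big) (adj? v) (λ u → Adj-sym ∘ proj₁) (λ u vu → Adj-sym vu , big)) (sym (+-identityʳ (deg v)))
    ... | no ¬big = #-none (λ u → adj? u v ×-dec no ¬big) (λ u → ¬big ∘ proj₂)

  -- v starts with charge (r + 1) deg v, a big vertex sends r to each neighbour, and every w in W receives
  -- r from its payer.
  module Discharging (noLeaves : NoLeaves) (f : Assign) (bounded : ∀ p → load f p ≤ cap p) where

    -- On the left stand the final charge demanded of a vertex that is not isolated and what it
    -- hands out, on the right its initial charge and what it receives.
    charge : ∀ v → (2 + 3 * r) * χ (NonIsolated? v) + (r * (χ (big? v) * deg v) + r * load f v) ≤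
                   suc r * deg v + (r * bigs v + r * χ (W? v))
    charge v with big? v | bounded v
    charge v | yes big | bd with NonIsolated? v | H ≤? deg v
    ... | no iso | _ = ⊥-elim (iso (≤-trans (s≤s z≤n) big))
    ... | yes _ | yes huge = begin
      (2 + 3 * r) * 1 + (r * (1 * deg v) + r * load f v) ≤⟨ +-monoʳ-≤ ((2 + 3 * r) * 1) (+-monoʳ-≤ (r * (1 * deg v)) (*-monoʳ-≤ r bd)) ⟩
      (2 + 3 * r) * 1 + (r * (1 * deg v) + r * (1 * M))  ≡⟨ arith r (deg v) M ⟩
      (2 + 3 * r + r * M) + r * deg v                    ≤⟨ +-monoˡ-≤ (r * deg v) huge ⟩
      suc r * deg v                                      ≤⟨ m≤m+n _ _ ⟩
      suc r * deg v + (r * bigs v + r * χ (W? v))        ∎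
      where
      open ≤-Reasoning
      arith : ∀ r d M → (2 + 3 * r) * 1 + (r * (1 * d) + r * (1 * M)) ≡ (2 + 3 * r + r * M) + r * d
      arith = solve-∀
    ... | yes _ | no _ = begin
      (2 + 3 * r) * 1 + (r * (1 * deg v) + r * load f v) ≤⟨ +-monoʳ-≤ ((2 + 3 * r) * 1) (+-monoʳ-≤ (r * (1 * deg v)) (*-monoʳ-≤ r bd)) ⟩
      (2 + 3 * r) * 1 + (r * (1 * deg v) + r * 0)        ≡⟨ arith r (deg v) ⟩
      (2 + 3 * r) + r * deg v                            ≤⟨ +-monoˡ-≤ (r * deg v) (≤-trans (n≤1+n _) (≤-trans (≤-reflexive (arith′ r)) big)) ⟩
      suc r * deg v                                      ≤⟨ m≤m+n _ _ ⟩
      suc r * deg v + (r * bigs v + r * χ (W? v))        ∎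
      where
      open ≤-Reasoning
      arith : ∀ r d → (2 + 3 * r) * 1 + (r * (1 * d) + r * 0) ≡ (2 + 3 * r) + r * d
      arith = solve-∀
      arith′ : ∀ r → 3 + 3 * r ≡ 3 * suc r
      arith′ = solve-∀
    charge v | no ¬big | bd with NonIsolated? v | 1 ≤? bigs v
    ... | no iso | yes b≥1 = ⊥-elim (iso (≤-trans b≥1 (#-mono (bigNbr? v) (adj? v) (λ _ → proj₁))))
    ... | no iso | no _ = ≤-trans (≤-reflexive (cong₂ _+_ (*-zeroʳ (2 + 3 * r)) (cong₂ _+_ (*-zeroʳ r)
                            (trans (cong (r *_) (n≤0⇒n≡0 bd)) (*-zeroʳ r))))) z≤n
    ... | yes d≥1 | yes b≥1 = begin
      (2 + 3 * r) * 1 + (r * 0 + r * load f v)                      ≤⟨ +-monoʳ-≤ ((2 + 3 * r) * 1) (+-monoʳ-≤ (r * 0) (*-monoʳ-≤ r bd)) ⟩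
      (2 + 3 * r) * 1 + (r * 0 + r * (1 * (deg v + bigs v ∸ 3)))    ≡⟨ arith r (deg v + bigs v ∸ 3) ⟩
      2 + r * (deg v + bigs v ∸ 3 + 3)                              ≡⟨ cong (λ t → 2 + r * t) (m∸n+n≡m (+-mono-≤ d≥2 b≥1)) ⟩
      2 + r * (deg v + bigs v)                                      ≤⟨ +-monoˡ-≤ (r * (deg v + bigs v)) d≥2 ⟩
      deg v + r * (deg v + bigs v)                                  ≡⟨ arith′ r (deg v) (bigs v) ⟩
      suc r * deg v + r * bigs v                                    ≤⟨ +-monoʳ-≤ (suc r * deg v) (m≤m+n _ _) ⟩
      suc r * deg v + (r * bigs v + r * χ (W? v))                   ∎
      where
      open ≤-Reasoning
      d≥2 : 2 ≤ deg v
      d≥2 = ≤∧≢⇒< d≥1 (noLeaves v ∘ sym)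
      arith : ∀ r d → (2 + 3 * r) * 1 + (r * 0 + r * (1 * d)) ≡ 2 + r * (d + 3)
      arith = solve-∀
      arith′ : ∀ r d b → d + r * (d + b) ≡ suc r * d + r * b
      arith′ = solve-∀
    ... | yes d≥1 | no ¬b≥1 = begin
      (2 + 3 * r) * 1 + (r * 0 + r * load f v)          ≤⟨ +-monoʳ-≤ ((2 + 3 * r) * 1) (+-monoʳ-≤ (r * 0) (*-monoʳ-≤ r bd)) ⟩
      (2 + 3 * r) * 1 + (r * 0 + r * 0)                 ≡⟨ arith r ⟩
      2 + 3 * r                                         ≤⟨ enough (deg v ≟ 2) ⟩
      suc r * deg v + r * χ (W? v)                      ≤⟨ +-monoʳ-≤ (suc r * deg v) (m≤n+m (r * χ (W? v)) (r * bigs v)) ⟩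
      suc r * deg v + (r * bigs v + r * χ (W? v))       ∎
      where
      open ≤-Reasoning
      arith : ∀ r → (2 + 3 * r) * 1 + (r * 0 + r * 0) ≡ 2 + 3 * r
      arith = solve-∀
      arith′ : ∀ r → 2 + 3 * r ≡ suc r * 2 + r * 1
      arith′ = solve-∀
      arith″ : ∀ r → 3 + 3 * r ≡ suc r * 3
      arith″ = solve-∀
      enough : Dec (deg v ≡ 2) → 2 + 3 * r ≤ suc r * deg v + r * χ (W? v)
      enough (yes d≡2) = ≤-reflexive (trans (arith′ r) (cong₂ (λ d w → suc r * d + r * w) (sym d≡2)
                           (sym (χ-yes (W? v) (d≡2 , n<1⇒n≡0 (≰⇒> ¬b≥1))))))
      enough (no d≢2) = ≤-trans (n≤1+n _) (≤-trans (≤-reflexive (arith″ r))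
        (≤-trans (*-monoʳ-≤ (suc r) (≤∧≢⇒< (≤∧≢⇒< d≥1 (noLeaves v ∘ sym)) (d≢2 ∘ sym))) (m≤m+n _ _)))

    -- Summed over all vertices, what is sent equals what is received and cancels. The average
    -- degree of the vertices that are not isolated is thus at least 3 - 1 / (r + 1).
    dense : (2 + 3 * r) * # NonIsolated? ≤ suc r * sumF deg
    dense = +-cancelʳ-≤ (r * sumF bigs + r * # W?) _ _ (begin
      (2 + 3 * r) * # NonIsolated? + (r * sumF bigs + r * # W?)
        ≡⟨ cong ((2 + 3 * r) * # NonIsolated? +_) (cong₂ _+_ (cong (r *_) bigs-sum) (cong (r *_) (sym (#-fibres W? f)))) ⟩
      (2 + 3 * r) * # NonIsolated? + (r * sumF (λ v → χ (big? v) * deg v) + r * sumF (load f))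
        ≡⟨ split (2 + 3 * r) r r (χ ∘ NonIsolated?) (λ v → χ (big? v) * deg v) (load f) ⟨
      sumF (λ v → (2 + 3 * r) * χ (NonIsolated? v) + (r * (χ (big? v) * deg v) + r * load f v))
        ≤⟨ sumF-mono charge ⟩
      sumF (λ v → suc r * deg v + (r * bigs v + r * χ (W? v)))
        ≡⟨ split (suc r) r r deg bigs (χ ∘ W?) ⟩
      suc r * sumF deg + (r * sumF bigs + r * # W?) ∎)
      where
      open ≤-Reasoning
      split : ∀ a b c (f g h : Fin n → ℕ) → sumF (λ v → a * f v + (b * g v + c * h v)) ≡ a * sumF f + (b * sumF g + c * sumF h)
      split a b c f g h = trans (sumF-+ (λ v → a * f v) (λ v → b * g v + c * h v))
        (cong₂ _+_ (sumF-* a f) (trans (sumF-+ (λ v → b * g v) (λ v → c * h v)) (cong₂ _+_ (sumF-* b g) (sumF-* c h))))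

-- Deleting an edge and recolouring

Cut : Fin n → Fin n → Fin n → Fin n → Set
Cut u w a b = (a ≡ u × b ≡ w) ⊎ (a ≡ w × b ≡ u)

module Delete (e : Fin n → Fin n → Bool) (e-sym : ∀ u v → e u v ≡ e v u) (u w : Fin n) where

  cut? : ∀ a b → Dec (Cut u w a b)
  cut? a b = ((a F.≟ u) ×-dec (b F.≟ w)) ⊎-dec ((a F.≟ w) ×-dec (b F.≟ u))

  cut-sym : ∀ {a b} → Cut u w a b → Cut u w b a
  cut-sym (inj₁ (p , q)) = inj₂ (q , p)
  cut-sym (inj₂ (p , q)) = inj₁ (q , p)

  delete : Fin n → Fin n → Bool
  delete a b with cut? a b
  ... | yes _ = false
  ... | no _  = e a b

  delete⁻ : ∀ a b → delete a b ≡ true → e a b ≡ true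
  delete⁻ a b h with cut? a b
  ... | no _ = h

  delete⁺ : ∀ {a b} → e a b ≡ true → ¬ Cut u w a b → delete a b ≡ true
  delete⁺ {a} {b} h ¬cut with cut? a b
  ... | yes cut = ⊥-elim (¬cut cut)
  ... | no _    = h

  delete-cut : delete u w ≢ true
  delete-cut with cut? u w
  ... | yes _   = λ ()
  ... | no ¬cut = ⊥-elim (¬cut (inj₁ (refl , refl)))

  delete-sym : ∀ a b → delete a b ≡ delete b a
  delete-sym a b with cut? a b | cut? b a
  ... | yes _ | yes _   = refl
  ... | no _  | no _    = e-sym a b
  ... | yes c | no ¬c   = ⊥-elim (¬c (cut-sym c))
  ... | no ¬c | yes c   = ⊥-elim (¬c (cut-sym c))

module Reduction (e : Fin n → Fin n → Bool) (e-sym : ∀ u v → e u v ≡ e v u) (r k : ℕ)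
                 (L : Fin n → List ℕ) (L-unique : ∀ v → Unique (L v)) (L-length : ∀ v → length (L v) ≡ k) where

  open Edges e e-sym r

  InLists : (Fin n → ℕ) → Set
  InLists c = ∀ v → c v ∈ L v

  ProperOff : (Fin n → Set) → (Fin n → ℕ) → Set
  ProperOff X c = ∀ a b → ¬ X a → ¬ X b → Conf a b → c a ≢ c b

  -- The conflicts after deleting uw, spelled out with `Cut` so that reducibility refers to a single
  -- graph.
  ConfWithout : Fin n → Fin n → Fin n → Fin n → Set
  ConfWithout u w a b = a ≢ b × ∃ λ m → (Adj a m × ¬ Cut u w a m) × (Adj b m × ¬ Cut u w b m)

  Reducible : Set
  Reducible = ∃₂ λ u w → Adj u w × (∀ c → InLists c → (∀ a b → ConfWithout u w a b → c a ≢ c b) →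
                                    ∃ λ c′ → InLists c′ × ∀ a b → Conf a b → c′ a ≢ c′ b)

  Easy : Fin n → Set
  Easy u = # (conf? u) < k

  abstract
    easy? : ∀ u → Dec (Easy u)
    easy? u = # (conf? u) <? k

  -- A conflict that depends on the deleted edge has `u` or `w` as one of its two vertices, so
  -- ignoring these two hides every such conflict.
  properOff-ends : ∀ {u w X c} → (∀ {a} → a ≡ u ⊎ a ≡ w → X a) →
                   (∀ a b → ConfWithout u w a b → c a ≢ c b) → ProperOff X c
  properOff-ends ends proper a b ¬Xa ¬Xb (a≢b , m , am , bm) = proper a b (a≢b , m , (am , off ¬Xa) , (bm , off ¬Xb))
    where
    off : ∀ {a} → ¬ _ → ¬ Cut _ _ a m
    off ¬Xa (inj₁ (a≡u , _)) = ¬Xa (ends (inj₁ a≡u))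
    off ¬Xa (inj₂ (a≡w , _)) = ¬Xa (ends (inj₂ a≡w))

  -- Greedy choice: fewer than `k` conflicts cannot exhaust the list of `u`. The old colours on `X`
  -- are avoided as well, which `Easy` permits since it counts all conflicts.
  recolour : ∀ {X : Fin n → Set} u → Easy u → ∀ c → InLists c → ProperOff (λ a → a ≡ u ⊎ X a) c →
             ∃ λ c′ → InLists c′ × ProperOff X c′
  recolour {X} u easy c c∈ proper = c′ , c′∈ , c′-proper
    where
    free : ∃ (_∈ available (conf? u) c (L u))
    free = nonempty _ (+-cancelˡ-< (# (conf? u)) 0 _ (≤-trans (s≤s (≤-reflexive (+-identityʳ _)))
             (≤-trans easy (≤-trans (≤-reflexive (sym (L-length u))) (length-available (L u) (conf? u) c (L-unique u))))))
    x = proj₁ free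
    x-ok : x ∈ L u × (∀ b → Conf u b → x ≢ c b)
    x-ok = available⁻ (L u) (conf? u) c (proj₂ free)
    c′ : Fin n → ℕ
    c′ a with a F.≟ u
    ... | yes _ = x
    ... | no _  = c a
    c′∈ : InLists c′
    c′∈ a with a F.≟ u
    ... | yes refl = proj₁ x-ok
    ... | no _     = c∈ a
    c′-proper : ProperOff X c′
    c′-proper a b ¬Xa ¬Xb conf with a F.≟ u | b F.≟ u
    ... | yes refl | yes refl = λ _ → proj₁ conf refl
    ... | yes refl | no _     = proj₂ x-ok b conf
    ... | no _     | yes refl = proj₂ x-ok a (Conf-sym conf) ∘ sym
    ... | no a≢u   | no b≢u   = proper a b [ a≢u , ¬Xa ] [ b≢u , ¬Xb ] conf

  finish : ∀ u → Easy u → ∀ c → InLists c → ProperOff (_≡ u) c → ∃ λ c′ → InLists c′ × ∀ a b → Conf a b → c′ a ≢ c′ b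
  finish u easy c c∈ proper =
    let c′ , c′∈ , p = recolour {λ _ → ⊥} u easy c c∈ (λ a b ¬a ¬b → proper a b (¬a ∘ inj₁) (¬b ∘ inj₁))
    in c′ , c′∈ , λ a b → p a b (λ ()) (λ ())

  -- Light edges and vertices with few conflicts

  Light : Fin n → Fin n → Set
  Light u w = Adj u w × Easy u × (Easy w ⊎ deg u ≡ 1)

  abstract
    light? : ∀ u w → Dec (Light u w)
    light? u w = adj? u w ×-dec easy? u ×-dec (easy? w ⊎-dec (deg u ≟ 1))

  -- With two easy ends, `u` is recoloured first and `w` last. If `u` is a leaf, restoring the edge
  -- creates conflicts at `u` only, so `w` keeps its colour.
  light-reducible : ∀ {u w} → Light u w → Reducible
  light-reducible {u} {w} (uw , easy-u , inj₁ easy-w) = u , w , uw , λ c c∈ proper →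
    let c′ , c′∈ , p = recolour {_≡ w} u easy-u c c∈ (properOff-ends {u} {w} id proper) in finish w easy-w c′ c′∈ p
  light-reducible {u} {w} (uw , easy-u , inj₂ leaf) = u , w , uw , λ c c∈ proper → finish u easy-u c c∈
    λ { a b a≢u b≢u (a≢b , m , am , bm) → proper a b (a≢b , m , (am , off a≢b a≢u bm) , (bm , off (a≢b ∘ sym) b≢u am)) }
    where
    -- u has no neighbour besides w
    off : ∀ {a b m} → a ≢ b → a ≢ u → Adj b m → ¬ Cut u w a m
    off a≢b a≢u bm (inj₁ (a≡u , _))      = a≢u a≡u
    off a≢b a≢u bm (inj₂ (refl , refl)) = a≢b (#≤1⇒≡ (adj? u) (≤-reflexive leaf) uw (Adj-sym bm))

  module _ (deg≤k : ∀ v → deg v ≤ k) (k-large : threshold r ≤ k) where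

    -- All conflicts of a leaf lie among the neighbours of `w` other than the leaf itself.
    leaf-easy : ∀ {u w} → Adj u w → deg u ≡ 1 → Easy u
    leaf-easy {u} {w} uw leaf = ≤-trans (≤-trans (≤-reflexive (trans (+-comm 1 _) (cong (# (conf? u) +_) (sym (#-singleton u)))))
      (#-disjoint (conf? u) (λ b → b F.≟ u) (adj? w) (λ { b (_ , m , um , bm) → subst (λ x → Adj x b) (#≤1⇒≡ (adj? u) (≤-reflexive leaf) um uw) (Adj-sym bm) })
         (λ { b refl → Adj-sym uw }) (λ { b (u≢b , _) b≡u → u≢b (sym b≡u) }))) (deg≤k w)

    ViaSmall : Fin n → Fin n → Set
    ViaSmall x b = ∃ λ m → (Adj x m × ¬ Big m) × Adj m b

    viaSmall? : ∀ x b → Dec (ViaSmall x b)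
    viaSmall? x b = F.any? λ m → (adj? x m ×-dec ¬? (big? m)) ×-dec adj? m b

    viaSmall≤ : ∀ {x} → ¬ Big x → # (viaSmall? x) ≤ M * M
    viaSmall≤ {x} ¬big = begin
      # (viaSmall? x)                                                ≤⟨ #-union≤ (λ m → adj? x m ×-dec ¬? (big? m)) adj? ⟩
      sumF (λ m → χ (adj? x m ×-dec ¬? (big? m)) * deg m)            ≤⟨ sumF-mono pointwise ⟩
      sumF (λ m → M * χ (adj? x m))                                  ≡⟨ sumF-* M (χ ∘ adj? x) ⟩
      M * deg x                                                      ≤⟨ *-monoʳ-≤ M (<⇒≤ (≰⇒> ¬big)) ⟩
      M * M                                                          ∎
      where
      open ≤-Reasoning
      pointwise : ∀ m → χ (adj? x m ×-dec ¬? (big? m)) * deg m ≤ M * χ (adj? x m)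
      pointwise m with big? m
      ... | yes big = ≤-trans (≤-reflexive (cong (_* deg m) (χ-no (adj? x m ×-dec ¬? (yes big)) (λ p → proj₂ p big)))) z≤n
      ... | no ¬big = ≤-trans (*-mono-≤ (χ-mono (adj? x m ×-dec ¬? (no ¬big)) (adj? x m) proj₁) (<⇒≤ (≰⇒> ¬big))) (≤-reflexive (*-comm (χ (adj? x m)) M))

    small-easy : ∀ {x} → ¬ Big x → bigs x ≡ 0 → Easy x
    small-easy {x} ¬big b≡0 = ≤-<-trans (≤-trans (#-mono (conf? x) (viaSmall? x) via) (viaSmall≤ ¬big))
                                (<-≤-trans (m<n+m (M * M) {H} (s≤s z≤n)) k-large)
      where
      via : ∀ b → Conf x b → ViaSmall x b
      via b (_ , m , xm , bm) = m , (xm , λ big-m → <⇒≢ (#-pos (bigNbr? x) m (xm , big-m)) (sym b≡0)) , Adj-sym bm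

    -- Fewer than `H` conflicts come through `v` and at most `M * M` through small neighbours;
    -- `threshold` is the sum of these bounds.
    one-big-easy : ∀ {x v} → ¬ Big x → (∀ {m} → Adj x m → Big m → m ≡ v) → deg v < H → Easy x
    one-big-easy {x} {v} ¬big only small = begin-strict
      # (conf? x)                                        ≤⟨ sumF-mono (λ b → χ-union (conf? x b) (adj? v b) (viaSmall? x b) (via b)) ⟩
      sumF (λ b → χ (adj? v b) + χ (viaSmall? x b))      ≡⟨ sumF-+ (χ ∘ adj? v) (χ ∘ viaSmall? x) ⟩
      deg v + # (viaSmall? x)                            ≤⟨ +-monoʳ-≤ (deg v) (viaSmall≤ ¬big) ⟩
      deg v + M * M                                      <⟨ +-monoˡ-< (M * M) small ⟩
      H + M * M                                          ≤⟨ k-large ⟩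
      k                                                  ∎
      where
      open ≤-Reasoning
      via : ∀ b → Conf x b → Adj v b ⊎ ViaSmall x b
      via b (_ , m , xm , bm) with big? m
      ... | yes big-m = inj₁ (subst (λ y → Adj y b) (only xm big-m) (Adj-sym bm))
      ... | no ¬big-m = inj₂ (m , (xm , ¬big-m) , Adj-sym bm)

    noLight⇒noLeaves : (∀ u w → ¬ Light u w) → NoLeaves
    noLight⇒noLeaves noLight u leaf = let w , uw = #-witness (adj? u) (≤-reflexive (sym leaf)) in
      noLight u w (uw , leaf-easy uw leaf , inj₂ leaf)

-- The configuration given by a saturated set of payers

module Core (e : Fin n → Fin n → Bool) (e-sym : ∀ u v → e u v ≡ e v u) (r k : ℕ)
            (L : Fin n → List ℕ) (L-unique : ∀ v → Unique (L v)) (L-length : ∀ v → length (L v) ≡ k)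
            (deg≤k : ∀ v → Edges.deg e e-sym r v ≤ k)
            (k-large : threshold r ≤ k)
            (noLight : ∀ u w → ¬ Reduction.Light e e-sym r k L L-unique L-length u w)
            (sat : Edges.Saturated e e-sym r) where

  open Edges e e-sym r
  open Reduction e e-sym r k L L-unique L-length
  open Saturated sat

  R : Fin n → Set
  R w = W w × X (f w)

  abstract
    R? : ∀ w → Dec (R w)
    R? w = W? w ×-dec X? (f w)

  W-easy : ∀ {w} → W w → Easy w
  W-easy Ww = small-easy deg≤k k-large (W-small Ww) (proj₂ Ww)

  Claims : Fin n → Fin n → Set
  Claims x m = W m × f m ≡ x

  claims? : ∀ x m → Dec (Claims x m)
  claims? x m = W? m ×-dec (f m F.≟ x)

  End : Fin n → Set
  End x = ∃ λ w → R w × Adj w x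

  end-small : ∀ {x} → End x → ¬ Big x
  end-small (w , (Ww , _) , wx) = W-nbr-small Ww wx

  -- Vertices of `W` are easy, so an easy end would give a light edge.
  end-hard : ∀ {x} → End x → ¬ Easy x
  end-hard {x} (w , (Ww , _) , wx) easy = noLight w x (wx , W-easy Ww , inj₁ easy)

  end-bigs≥1 : ∀ {x} → End x → 1 ≤ bigs x
  end-bigs≥1 end = n≢0⇒n>0 (λ b≡0 → end-hard end (small-easy deg≤k k-large (end-small end) b≡0))

  end-X : ∀ {x} → End x → X x
  end-X (w , (Ww , Xfw) , wx) = closed Ww Xfw (inj₁ wx)

  -- By `end-X` the end is full, and its capacity is `deg x + bigs x ∸ 3`.
  end-load : ∀ {x} → End x → deg x + bigs x ≤ 3 + load f x
  end-load {x} end = ≤-trans (m≤n+m∸n (deg x + bigs x) 3) (+-monoʳ-≤ 3 (≤-trans cap≥ (saturated (end-X end))))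
    where
    cap≥ : deg x + bigs x ∸ 3 ≤ cap x
    cap≥ with big? x
    ... | yes big = ⊥-elim (end-small end big)
    ... | no _    = ≤-reflexive (sym (trans (cong (_* (deg x + bigs x ∸ 3)) (χ-yes (1 ≤? bigs x) (end-bigs≥1 end))) (+-identityʳ _)))

  claims-adj : ∀ {x m} → ¬ Big x → Claims x m → Adj x m
  claims-adj ¬big (Wm , refl) = Adj-sym (small-payer ¬big (valid _ Wm))

  -- Big neighbours and claimed neighbours are disjoint, so `bigs x + load f x ≤ deg x`. With
  -- `end-load` this leaves `2 * bigs x ≤ 3`.
  end-bigs≤1 : ∀ {x} → End x → bigs x ≤ 1
  end-bigs≤1 {x} end = half (bigs x) (+-cancelʳ-≤ (load f x) _ _ (begin
    bigs x + bigs x + load f x     ≡⟨ rearrange (bigs x) (load f x) ⟩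
    bigs x + load f x + bigs x     ≤⟨ +-monoˡ-≤ (bigs x) (#-disjoint (bigNbr? x) (claims? x) (adj? x) (λ _ → proj₁) (λ _ → claims-adj (end-small end))
                                        (λ { m (_ , big) (Wm , _) → W-small Wm big })) ⟩
    deg x + bigs x                 ≤⟨ end-load end ⟩
    3 + load f x                   ∎))
    where
    open ≤-Reasoning
    rearrange : ∀ b l → b + b + l ≡ b + l + b
    rearrange = solve-∀
    half : ∀ b → b + b ≤ 3 → b ≤ 1
    half 0 _ = z≤n
    half 1 _ = ≤-refl
    half (suc (suc b)) (s≤s (s≤s h)) rewrite +-suc b (suc b) | +-suc b b = ⊥-elim (<⇒≱ (s≤s (s≤s z≤n)) h)

  -- Two such neighbours would give `bigs x + load f x + 2 ≤ deg x`, hence `2 * bigs x + 2 ≤ 3` by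
  -- `end-load`, although an end has a big neighbour.
  unclaimed-unique : ∀ {x m m′} → End x → Adj x m → ¬ Big m → ¬ Claims x m →
                     Adj x m′ → ¬ Big m′ → ¬ Claims x m′ → m ≡ m′
  unclaimed-unique {x} {m} {m′} end xm ¬bm ¬cm xm′ ¬bm′ ¬cm′ = decidable-stable (m F.≟ m′) λ m≢m′ →
    <⇒≱ (too-many (end-bigs≥1 end)) (+-cancelʳ-≤ (load f x) _ _ (begin
      bigs x + bigs x + 2 + load f x         ≡⟨ rearrange (bigs x) (load f x) ⟩
      2 + (bigs x + load f x) + bigs x       ≤⟨ +-monoˡ-≤ (bigs x) (s≤s (s≤s (#-disjoint (bigNbr? x) (claims? x) other?
                                                   (λ { y (xy , big) → (xy , λ { refl → ¬bm big }) , λ { refl → ¬bm′ big } })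
                                                   (λ y cl → (claims-adj (end-small end) cl , λ { refl → ¬cm cl }) , λ { refl → ¬cm′ cl })
                                                   (λ { y (_ , big) (Wy , _) → W-small Wy big })))) ⟩
      2 + # other? + bigs x                  ≤⟨ +-monoˡ-≤ (bigs x) (s≤s (#-remove (λ y → adj? x y ×-dec ¬? (y F.≟ m)) m′ (xm′ , m≢m′ ∘ sym))) ⟩
      1 + # (λ y → adj? x y ×-dec ¬? (y F.≟ m)) + bigs x ≤⟨ +-monoˡ-≤ (bigs x) (#-remove (adj? x) m xm) ⟩
      deg x + bigs x                         ≤⟨ end-load end ⟩
      3 + load f x                           ∎))
    where
    open ≤-Reasoning
    other? : ∀ y → Dec ((Adj x y × y ≢ m) × y ≢ m′)
    other? y = (adj? x y ×-dec ¬? (y F.≟ m)) ×-dec ¬? (y F.≟ m′)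
    rearrange : ∀ b l → b + b + 2 + l ≡ 2 + (b + l) + b
    rearrange = solve-∀
    too-many : ∀ {b} → 1 ≤ b → 3 < b + b + 2
    too-many h = +-monoˡ-≤ 2 (+-mono-≤ h h)

  place : Fin n → Fin n
  place x with F.any? (bigNbr? x)
  ... | yes (v , _) = v
  ... | no _        = x

  place-big : ∀ {x} → End x → Adj x (place x) × Big (place x)
  place-big {x} end with F.any? (bigNbr? x)
  ... | yes (_ , p) = p
  ... | no ¬p = ⊥-elim (¬p (#-witness (bigNbr? x) (end-bigs≥1 end)))

  place-unique : ∀ {x v} → End x → Adj x v → Big v → v ≡ place x
  place-unique {x} end xv big = #≤1⇒≡ (bigNbr? x) (end-bigs≤1 end) (xv , big) (place-big end)

  -- If the big neighbour were not huge, `one-big-easy` would make the end easy. So it has capacity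
  -- `M`, and it is full because `X` is closed.
  end-load-place : ∀ {x} → End x → M ≤ load f (place x)
  end-load-place {x} end@(w , (Ww , Xfw) , wx) =
    ≤-trans cap≥ (saturated (closed Ww Xfw (inj₂ (proj₂ (place-big end) , x , wx , proj₁ (place-big end)))))
    where
    huge : H ≤ deg (place x)
    huge = ≮⇒≥ (λ small → end-hard end (one-big-easy deg≤k k-large (end-small end) (place-unique end) small))
    cap≥ : M ≤ cap (place x)
    cap≥ with big? (place x)
    ... | yes _   = ≤-reflexive (sym (trans (cong (_* M) (χ-yes (H ≤? deg (place x)) huge)) (+-identityʳ M)))
    ... | no ¬big = ⊥-elim (¬big (proj₂ (place-big end)))

  -- The neighbour of `w` on whose behalf a big payer `f w` pays; one is chosen if both qualify.
  side : Fin n → Fin n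
  side w with F.any? (λ x → adj? w x ×-dec adj? x (f w))
  ... | yes (x , _) = x
  ... | no _        = w

  side-adj : ∀ {w} → W w → Big (f w) → Adj w (side w) × Adj (side w) (f w)
  side-adj {w} Ww big with F.any? (λ x → adj? w x ×-dec adj? x (f w))
  ... | yes (_ , p) = p
  ... | no ¬p with valid w Ww
  ...   | inj₁ wfw     = ⊥-elim (W-nbr-small Ww wfw big)
  ...   | inj₂ (_ , p) = ⊥-elim (¬p p)

  -- Sinks and sources

  Root : Fin n → Fin n → Set
  Root x w = R w × Big (f w) × side w ≡ x

  Sink : Fin n → Set
  Sink x = ∃ (Root x)

  abstract
    sink? : ∀ x → Dec (Sink x)
    sink? x = F.any? λ w → R? w ×-dec big? (f w) ×-dec (side w F.≟ x)

  SharesWithSink : Fin n → Fin n → Set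
  SharesWithSink x w = R w × Adj w x × ∃ λ z → Sink z × Adj w z × z ≢ x

  S : Fin n → Set
  S x = Sink x ⊎ ∃ (SharesWithSink x)

  abstract
    S? : ∀ x → Dec (S x)
    S? x = sink? x ⊎-dec F.any? λ w → R? w ×-dec adj? w x ×-dec F.any? λ z → sink? z ×-dec adj? w z ×-dec ¬? (z F.≟ x)

  root-adj : ∀ {x w} → Root x w → Adj w x
  root-adj ((Ww , _) , big , refl) = proj₁ (side-adj Ww big)

  sink-end : ∀ {x} → Sink x → End x
  sink-end (w , root) = w , proj₁ root , root-adj root

  S-end : ∀ {x} → S x → End x
  S-end (inj₁ sink) = sink-end sink
  S-end (inj₂ (w , Rw , wx , _)) = w , Rw , wx

  claimed-R : ∀ {x m} → End x → Claims x m → R m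
  claimed-R end (Wm , refl) = Wm , end-X end

  root-unclaimed : ∀ {x w y} → Root x w → ¬ Big y → ¬ Claims y w
  root-unclaimed (_ , big , _) ¬big (_ , refl) = ¬big big

  -- The root is paid by a big vertex, so it is the single small neighbour that `x` leaves
  -- unclaimed.
  sink-nbr : ∀ {x m} → Sink x → Adj x m → ¬ Big m → Claims x m ⊎ Root x m
  sink-nbr {x} {m} sink@(w , root) xm ¬bm with claims? x m
  ... | yes cl = inj₁ cl
  ... | no ¬cl = inj₂ (subst (Root x) (unclaimed-unique end (Adj-sym (root-adj root)) (W-small (proj₁ (proj₁ root)))
                   (root-unclaimed root (end-small end)) xm ¬bm ¬cl) root)
    where end = sink-end sink

  -- The shared `w` is either claimed by the sink `z` or its root, hence not claimed by `x`; so it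
  -- is the one unclaimed small neighbour of `x`.
  sharing-nbr : ∀ {x m} → ∃ (SharesWithSink x) → Adj x m → ¬ Big m → Claims x m ⊎ SharesWithSink x m
  sharing-nbr {x} {m} near@(w , share@(Rw , wx , z , sink , wz , z≢x)) xm ¬bm with claims? x m
  ... | yes cl = inj₁ cl
  ... | no ¬cl = inj₂ (subst (SharesWithSink x) (unclaimed-unique end (Adj-sym wx) (W-small (proj₁ Rw)) ¬claim xm ¬bm ¬cl) share)
    where
    end = S-end (inj₂ near)
    ¬claim : ¬ Claims x w
    ¬claim cl with sink-nbr sink (Adj-sym wz) (W-small (proj₁ Rw))
    ... | inj₁ (_ , fw≡z) = z≢x (trans (sym fw≡z) (proj₂ cl))
    ... | inj₂ root       = root-unclaimed root (end-small end) cl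

  S-nbr : ∀ {x m} → S x → Adj x m → ¬ Big m → R m
  S-nbr s@(inj₁ sink) xm ¬bm with sink-nbr sink xm ¬bm
  ... | inj₁ cl   = claimed-R (S-end s) cl
  ... | inj₂ root = proj₁ root
  S-nbr s@(inj₂ near) xm ¬bm with sharing-nbr near xm ¬bm
  ... | inj₁ cl    = claimed-R (S-end s) cl
  ... | inj₂ share = proj₁ share

  -- The payment of a small common neighbour would belong to both sinks, but `f m` and `side m` are
  -- single vertices, and a payer cannot be both big and small.
  sinks-independent : ∀ {a b m} → a ≢ b → Sink a → Sink b → Adj a m → Adj b m → Big m
  sinks-independent {a} {b} {m} a≢b sa sb am bm = decidable-stable (big? m) λ ¬bm →
    absurd (sink-nbr sa am ¬bm) (sink-nbr sb bm ¬bm)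
    where
    absurd : Claims a m ⊎ Root a m → Claims b m ⊎ Root b m → ⊥
    absurd (inj₁ (_ , fm≡a)) (inj₁ (_ , fm≡b)) = a≢b (trans (sym fm≡a) fm≡b)
    absurd (inj₁ cl) (inj₂ root) = root-unclaimed root (end-small (sink-end sa)) cl
    absurd (inj₂ root) (inj₁ cl) = root-unclaimed root (end-small (sink-end sb)) cl
    absurd (inj₂ (_ , _ , refl)) (inj₂ (_ , _ , e)) = a≢b e

  -- A small vertex that `a` shares with a sink has degree 2, so `b` would be that sink. Hence both
  -- sources claim `m`, which has only one payer.
  sources-independent : ∀ {a b m} → a ≢ b → ¬ Sink a → ¬ Sink b → S a → S b → Adj a m → Adj b m → Big m
  sources-independent {a} {b} {m} a≢b ¬sa ¬sb Sa Sb am bm = decidable-stable (big? m) λ ¬bm →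
    a≢b (trans (sym (claimed a≢b ¬sa ¬sb Sa am bm ¬bm)) (claimed (a≢b ∘ sym) ¬sb ¬sa Sb bm am ¬bm))
    where
    claimed : ∀ {a b} → a ≢ b → ¬ Sink a → ¬ Sink b → S a → Adj a m → Adj b m → ¬ Big m → f m ≡ a
    claimed a≢b ¬sa ¬sb (inj₁ sa) am bm ¬bm = ⊥-elim (¬sa sa)
    claimed {a} {b} a≢b ¬sa ¬sb (inj₂ near) am bm ¬bm with sharing-nbr near am ¬bm
    ... | inj₁ cl = proj₂ cl
    ... | inj₂ ((Wm , _) , _ , z , sz , mz , z≢a) =
      ⊥-elim (¬sb (subst Sink (#≤2⇒≡ (adj? m) (≤-reflexive (proj₁ Wm)) (Adj-sym am) mz (Adj-sym bm) z≢a (a≢b ∘ sym)) sz))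

  SinkAt : Fin n → Fin n → Set
  SinkAt p y = Sink y × Adj p y

  sinkAt? : ∀ p y → Dec (SinkAt p y)
  sinkAt? p y = sink? y ×-dec adj? p y

  -- The saturated `place x` pays for at least `M` vertices. Their sides are sinks next to it, and
  -- distinct ones by `unclaimed-unique`.
  many-sinks : ∀ {x} → End x → M ≤ # (sinkAt? (place x))
  many-sinks {x} end = ≤-trans (end-load-place end) (#-injective (λ w → W? w ×-dec (f w F.≟ p)) (sinkAt? p) side into inj)
    where
    p = place x
    Xp : X p
    Xp = let w , (Ww , Xfw) , wx = end in closed Ww Xfw (inj₂ (proj₂ (place-big end) , x , wx , proj₁ (place-big end)))
    root : ∀ w → W w × f w ≡ p → Root (side w) w
    root w (Ww , e) = (Ww , subst X (sym e) Xp) , subst Big (sym e) (proj₂ (place-big end)) , refl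
    into : ∀ w → W w × f w ≡ p → SinkAt p (side w)
    into w c@(Ww , e) = (w , root w c) , Adj-sym (subst (Adj (side w)) e (proj₂ (side-adj Ww (proj₁ (proj₂ (root w c))))))
    inj : ∀ w w′ → W w × f w ≡ p → W w′ × f w′ ≡ p → side w ≡ side w′ → w ≡ w′
    inj w w′ c c′ same = unclaimed-unique end-y (Adj-sym (root-adj ry)) (W-small (proj₁ c)) (root-unclaimed ry ¬by)
                           (Adj-sym (root-adj ry′)) (W-small (proj₁ c′)) (root-unclaimed ry′ ¬by)
      where
      ry = root w c
      ry′ : Root (side w) w′
      ry′ = subst (λ y → Root y w′) (sym same) (root w′ c′)
      end-y = sink-end (w , ry)
      ¬by = end-small end-y

  -- The orientation of the conflicts inside the core

  Clash : Fin n → Fin n → Set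
  Clash a b = ∃ λ m → (Adj a m × ¬ Big m) × (Adj m b × b ≢ a)

  clash? : ∀ a b → Dec (Clash a b)
  clash? a b = F.any? λ m → (adj? a m ×-dec ¬? (big? m)) ×-dec (adj? m b ×-dec ¬? (b F.≟ a))

  -- The offset `n` puts all sinks below all sources, smaller ranks being higher.
  rank : Fin n → ℕ
  rank a = χ (sink? a) * n + toℕ a

  rank-source : ∀ {a} → ¬ Sink a → rank a ≡ toℕ a
  rank-source {a} ¬s = cong (λ t → t * n + toℕ a) (χ-no (sink? a) ¬s)

  rank-sink : ∀ {a} → Sink a → rank a ≡ n + toℕ a
  rank-sink {a} s = trans (cong (λ t → t * n + toℕ a) (χ-yes (sink? a) s)) (cong (_+ toℕ a) (+-identityʳ n))

  source<sink : ∀ {a b} → ¬ Sink a → Sink b → rank a < rank b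
  source<sink {a} {b} ¬sa sb = subst₂ _<_ (sym (rank-source ¬sa)) (sym (rank-sink sb)) (<-≤-trans (F.toℕ<n a) (m≤m+n n _))

  rank-injective : ∀ {a b} → rank a ≡ rank b → a ≡ b
  rank-injective {a} {b} eq with sink? a | sink? b
  ... | yes _ | yes _ = F.toℕ-injective (+-cancelˡ-≡ (1 * n) _ _ eq)
  ... | no _  | no _  = F.toℕ-injective eq
  ... | yes _ | no _  = ⊥-elim (<⇒≢ (<-≤-trans (F.toℕ<n b) (≤-trans (m≤m+n n 0) (m≤m+n (1 * n) _))) (sym eq))
  ... | no _  | yes _ = ⊥-elim (<⇒≢ (<-≤-trans (F.toℕ<n a) (≤-trans (m≤m+n n 0) (m≤m+n (1 * n) _))) eq)

  open Kernel place rank sink? clash?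

  -- A common big neighbour is the `place` of both, so `rank` decides. A common small one joins a
  -- sink to a source, by the two independence lemmas.
  conf-out : ∀ {a b} → S a → S b → Conf a b → Out a b ⊎ Out b a
  conf-out {a} {b} Sa Sb (a≢b , m , am , bm) with big? m
  ... | yes big with <-cmp (rank a) (rank b)
  ...   | tri< lt _ _ = inj₂ (inj₁ (trans (sym (place-unique (S-end Sb) bm big)) (place-unique (S-end Sa) am big) , lt))
  ...   | tri≈ _ eq _ = ⊥-elim (a≢b (rank-injective eq))
  ...   | tri> _ _ gt = inj₁ (inj₁ (trans (sym (place-unique (S-end Sa) am big)) (place-unique (S-end Sb) bm big) , gt))
  conf-out {a} {b} Sa Sb (a≢b , m , am , bm) | no ¬big with sink? a | sink? b
  ... | yes sa | yes sb = ⊥-elim (¬big (sinks-independent a≢b sa sb am bm))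
  ... | no ¬sa | no ¬sb = ⊥-elim (¬big (sources-independent a≢b ¬sa ¬sb Sa Sb am bm))
  ... | yes sa | no ¬sb = inj₂ (inj₂ (¬sb , sa , m , (bm , ¬big) , Adj-sym am , a≢b))
  ... | no ¬sa | yes sb = inj₁ (inj₂ (¬sa , sb , m , (am , ¬big) , Adj-sym bm , a≢b ∘ sym))

  -- Counting what blocks a vertex of the core

  Frozen : Fin n → Fin n → Set
  Frozen a b = ¬ S b × Conf a b

  abstract
    frozen? : ∀ a b → Dec (Frozen a b)
    frozen? a b = ¬? (S? b) ×-dec conf? a b

  SOut? : ∀ a b → Dec (S b × Out a b)
  SOut? a b = S? b ×-dec out? a b

  Blocked : Fin n → Fin n → Set
  Blocked a b = (S b × Out a b) ⊎ Frozen a b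

  abstract
    blocked? : ∀ a b → Dec (Blocked a b)
    blocked? a b = SOut? a b ⊎-dec frozen? a b

  blocked-sum : ∀ a → outdegree S? a + # (frozen? a) ≤ # (blocked? a)
  blocked-sum a = #-disjoint (SOut? a) (frozen? a) (blocked? a) (λ _ → inj₁) (λ _ → inj₂) (λ { b (Sb , _) (¬Sb , _) → ¬Sb Sb })

  above-adj : ∀ {a b} → S b → Above a b → Adj (place a) b
  above-adj {a} {b} Sb (same , _) = subst (λ p → Adj p b) (sym same) (Adj-sym (proj₁ (place-big (S-end Sb))))

  blocked-place : ∀ {a b} → S a → Blocked a b → Adj (place a) b ⊎ Clash a b
  blocked-place Sa (inj₁ (Sb , inj₁ above)) = inj₁ (above-adj Sb above)
  blocked-place Sa (inj₁ (Sb , inj₂ (_ , _ , clash))) = inj₂ clash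
  blocked-place {a} {b} Sa (inj₂ (_ , a≢b , m , am , bm)) with big? m
  ... | yes big = inj₁ (subst (λ p → Adj p b) (place-unique (S-end Sa) am big) (Adj-sym bm))
  ... | no ¬big = inj₂ (m , (am , ¬big) , Adj-sym bm , a≢b ∘ sym)

  blocked-irrefl : ∀ {a} → ¬ Blocked a a
  blocked-irrefl (inj₁ (_ , inj₁ (_ , lt)))       = <-irrefl refl lt
  blocked-irrefl (inj₁ (_ , inj₂ (¬sa , sa , _))) = ¬sa sa
  blocked-irrefl (inj₂ (_ , a≢a , _))             = a≢a refl

  -- A vertex clashing with a sink shares a vertex of `R` with it, so it lies in `S` and is not
  -- frozen, and sinks send no arcs along clashes. Only the other neighbours of `place a` can block.
  sink-blocked : ∀ {a} → Sink a → # (blocked? a) < k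
  sink-blocked {a} sa = ≤-trans (≤-trans (≤-reflexive (trans (+-comm 1 _) (cong (# (blocked? a) +_) (sym (#-singleton a)))))
    (#-disjoint (blocked? a) (λ b → b F.≟ a) (adj? (place a)) at-place
      (λ { _ refl → Adj-sym (proj₁ (place-big (sink-end sa))) }) (λ { _ bl refl → blocked-irrefl bl }))) (deg≤k (place a))
    where
    at-place : ∀ b → Blocked a b → Adj (place a) b
    at-place b (inj₁ (Sb , inj₁ above)) = above-adj Sb above
    at-place b (inj₁ (Sb , inj₂ (¬sa , _))) = ⊥-elim (¬sa sa)
    at-place b bl@(inj₂ (¬Sb , _)) with blocked-place (inj₁ sa) bl
    ... | inj₁ pb = pb
    ... | inj₂ (m , (am , ¬big) , mb , b≢a) =
      ⊥-elim (¬Sb (inj₂ (m , S-nbr (inj₁ sa) am ¬big , mb , a , sa , Adj-sym am , b≢a ∘ sym)))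

  -- Small neighbours of `a` are in `R` and have degree 2, so each contributes at most one clash.
  clash≤ : ∀ {a} → S a → # (clash? a) ≤ deg a
  clash≤ {a} Sa = ≤-trans (#-union≤ (λ m → adj? a m ×-dec ¬? (big? m)) (λ m b → adj? m b ×-dec ¬? (b F.≟ a))) (sumF-mono pointwise)
    where
    pointwise : ∀ m → χ (adj? a m ×-dec ¬? (big? m)) * # (λ b → adj? m b ×-dec ¬? (b F.≟ a)) ≤ χ (adj? a m)
    pointwise m = via (adj? a m ×-dec ¬? (big? m))
      where
      via : (d : Dec (Adj a m × ¬ Big m)) → χ d * # (λ b → adj? m b ×-dec ¬? (b F.≟ a)) ≤ χ (adj? a m)
      via (no _) = z≤n
      via (yes (am , ¬big)) = ≤-trans (≤-reflexive (+-identityʳ _)) (≤-trans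
        (≤-pred (≤-trans (#-remove (adj? m) a (Adj-sym am)) (≤-reflexive (proj₁ (proj₁ (S-nbr Sa am ¬big))))))
        (≤-reflexive (sym (χ-yes (adj? a m) am))))

  -- Of the neighbours of `place a`, the source itself and at least `M` sinks do not block through
  -- that place; this makes up for the fewer than `M` clashes.
  source-blocked : ∀ {a} → S a → ¬ Sink a → # (blocked? a) < k
  source-blocked {a} Sa ¬sa = +-cancelʳ-≤ M _ _ (begin
    suc (# (blocked? a)) + M                                           ≤⟨ +-monoʳ-≤ (suc (# (blocked? a))) (many-sinks (S-end Sa)) ⟩
    1 + # (blocked? a) + # (sinkAt? p)                                 ≡⟨ cong (λ t → t + # (blocked? a) + # (sinkAt? p)) (#-singleton a) ⟨
    # (λ b → b F.≟ a) + # (blocked? a) + # (sinkAt? p)                 ≡⟨ cong (_+ # (sinkAt? p)) (sumF-+ (λ b → χ (b F.≟ a)) (χ ∘ blocked? a)) ⟨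
    sumF (λ b → χ (b F.≟ a) + χ (blocked? a b)) + # (sinkAt? p)        ≡⟨ sumF-+ (λ b → χ (b F.≟ a) + χ (blocked? a b)) (χ ∘ sinkAt? p) ⟨
    sumF (λ b → χ (b F.≟ a) + χ (blocked? a b) + χ (sinkAt? p b))      ≤⟨ sumF-mono (λ b → pointwise b (b F.≟ a) (blocked? a b) (sinkAt? p b) (adj? p b) (clash? a b)) ⟩
    sumF (λ b → χ (adj? p b) + χ (clash? a b))                         ≡⟨ sumF-+ (χ ∘ adj? p) (χ ∘ clash? a) ⟩
    deg p + # (clash? a)                                               ≤⟨ +-mono-≤ (deg≤k p) (≤-trans (clash≤ Sa) (<⇒≤ (≰⇒> (end-small (S-end Sa))))) ⟩
    k + M                                                              ∎)
    where
    open ≤-Reasoning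
    p = place a
    -- A sink at p lies below a, so it can block a only through a clash.
    pointwise : ∀ b (eq : Dec (b ≡ a)) (bl : Dec (Blocked a b)) (si : Dec (SinkAt p b)) (pb : Dec (Adj p b)) (cl : Dec (Clash a b)) →
                χ eq + χ bl + χ si ≤ χ pb + χ cl
    pointwise b (yes refl) (yes bl) _ _ _ = ⊥-elim (blocked-irrefl bl)
    pointwise b (yes refl) _ (yes (sb , _)) _ _ = ⊥-elim (¬sa sb)
    pointwise b (yes refl) (no _) (no _) pb cl rewrite χ-yes pb (Adj-sym (proj₁ (place-big (S-end Sa)))) = s≤s z≤n
    pointwise b (no _) (no _) (no _) pb cl = z≤n
    pointwise b (no _) (no _) (yes (_ , ab)) pb cl rewrite χ-yes pb ab = s≤s z≤n
    pointwise b (no _) (yes bl) (no _) pb cl with blocked-place Sa bl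
    ... | inj₁ ab rewrite χ-yes pb ab = s≤s z≤n
    ... | inj₂ ac rewrite χ-yes cl ac = m≤n+m 1 (χ pb)
    pointwise b (no _) (yes (inj₁ (_ , inj₁ (_ , lt)))) (yes (sb , _)) pb cl = ⊥-elim (<-asym lt (source<sink ¬sa sb))
    pointwise b (no _) (yes (inj₁ (_ , inj₂ (_ , _ , ac)))) (yes (_ , ab)) pb cl rewrite χ-yes pb ab | χ-yes cl ac = ≤-refl
    pointwise b (no _) (yes (inj₂ (¬Sb , _))) (yes (sb , _)) pb cl = ⊥-elim (¬Sb (inj₁ sb))

  blocked<k : ∀ {a} → S a → # (blocked? a) < k
  blocked<k {a} Sa = [ sink-blocked , source-blocked Sa ]′ (toSum (sink? a))

  -- Recolouring the core

  some-root : ∃₂ Root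
  some-root =
    let w , Ww , Xfw = inhabited
        x , wx       = #-witness (adj? w) (≤-trans (s≤s z≤n) (≤-reflexive (sym (proj₁ Ww))))
        z , (w′ , root) , _ = #-witness (sinkAt? (place x)) (≤-trans (s≤s z≤n) (many-sinks (w , (Ww , Xfw) , wx)))
    in z , w′ , root

  Free : (Fin n → ℕ) → Fin n → List ℕ
  Free c a = available (frozen? a) c (L a)

  core-colouring : ∀ c → Colouring S (Free c)
  core-colouring c = list-colouring n S? (#≤n S?) (Free c) (λ a → available-unique (L a) (frozen? a) c (L-unique a)) enough
    where
    enough : ∀ a → S a → outdegree S? a < length (Free c a)
    enough a Sa = +-cancelˡ-< (# (frozen? a)) _ _ (<-≤-trans (≤-<-trans (≤-trans (≤-reflexive (+-comm (# (frozen? a)) _)) (blocked-sum a)) (blocked<k Sa))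
      (≤-trans (≤-reflexive (sym (L-length a))) (length-available (L a) (frozen? a) c (L-unique a))))

  recolour-core : ∀ {w} c → InLists c → ProperOff (λ a → a ≡ w ⊎ S a) c → Colouring S (Free c) →
                  ∃ λ c′ → InLists c′ × ProperOff (_≡ w) c′
  recolour-core {w} c c∈ outside (d , d∈ , d≢) = c′ , c′∈ , c′-proper
    where
    d-ok : ∀ a → S a → d a ∈ L a × (∀ b → Frozen a b → d a ≢ c b)
    d-ok a Sa = available⁻ (L a) (frozen? a) c (d∈ a Sa)
    c′ : Fin n → ℕ
    c′ a with S? a
    ... | yes _ = d a
    ... | no _  = c a
    c′∈ : InLists c′
    c′∈ a with S? a
    ... | yes Sa = proj₁ (d-ok a Sa)
    ... | no _   = c∈ a
    c′-proper : ProperOff (_≡ w) c′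
    c′-proper a b a≢w b≢w conf with S? a | S? b
    ... | no ¬Sa | no ¬Sb = outside a b [ a≢w , ¬Sa ] [ b≢w , ¬Sb ] conf
    ... | yes Sa | no ¬Sb = proj₂ (d-ok a Sa) b (¬Sb , conf)
    ... | no ¬Sa | yes Sb = proj₂ (d-ok b Sb) a (¬Sa , Conf-sym conf) ∘ sym
    ... | yes Sa | yes Sb with conf-out Sa Sb conf
    ...   | inj₁ o = d≢ a b Sa Sb o
    ...   | inj₂ o = d≢ b a Sb Sa o ∘ sym

  -- The deleted edge joins a sink to its root. The sink is recoloured with the core, and the root,
  -- an easy vertex of `W`, last.
  core-reducible : Reducible
  core-reducible = reduce some-root
    where
    reduce : ∃₂ Root → Reducible
    reduce (z , w , root) = z , w , Adj-sym (root-adj root) , λ c c∈ proper →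
      let outside = properOff-ends {z} {w} (λ { (inj₁ refl) → inj₂ (inj₁ (w , root)) ; (inj₂ e) → inj₁ e }) proper
          c′ , c′∈ , p = recolour-core {w} c c∈ outside (core-colouring c)
      in finish w (W-easy (proj₁ (proj₁ root))) c′ c′∈ p

-- The density bound in natural numbers

open import Data.Integer using (+_; -[1+_])
import Data.Integer as ℤ
import Data.Integer.Properties as ℤ
import Data.Integer.Tactic.RingSolver as ℤSolver
open import Data.Rational using (ℚ; mkℚ; _-_; 0ℚ; _/_; toℚᵘ) renaming (_<_ to _<ℚ_)
import Data.Rational as ℚ
import Data.Rational.Properties as ℚ
open import Data.Rational.Unnormalised using (mkℚᵘ)
import Data.Rational.Unnormalised as ℚᵘ
import Data.Rational.Unnormalised.Properties as ℚᵘ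

-- Here ε = (p + 1) / (r + 1) ≥ 1 / (r + 1). Denominators are cleared, and the subtracted term is
-- moved to the left before returning to natural numbers.
ratio-below : ∀ a d ε p r → toℚᵘ ε ≡ mkℚᵘ (+ suc p) r → ratio a (suc d) <ℚ (+ 3 / 1) - ε → suc r * a < (2 + 3 * r) * suc d
ratio-below a d ε p r ε≡ lt = +-cancelʳ-< (suc d) _ _ (begin-strict
  suc r * a + suc d                  ≤⟨ +-monoʳ-≤ (suc r * a) (m≤n*m (suc d) (suc p)) ⟩
  suc r * a + suc p * suc d          ≡⟨ cong (_+ suc p * suc d) (*-comm (suc r) a) ⟩
  a * suc r + suc p * suc d          <⟨ ℤ.drop‿+<+ in-ℤ ⟩
  3 * suc r * suc d                  ≡⟨ arith r d ⟩
  (2 + 3 * r) * suc d + suc d        ∎)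
  where
  open ≤-Reasoning
  arith : ∀ r d → 3 * suc r * suc d ≡ (2 + 3 * r) * suc d + suc d
  arith = solve-∀
  in-ℚᵘ : mkℚᵘ (+ a) d ℚᵘ.< mkℚᵘ (+ 3) 0 ℚᵘ.- mkℚᵘ (+ suc p) r
  in-ℚᵘ = ℚᵘ.<-respʳ-≃ (ℚᵘ.≃-trans (ℚ.toℚᵘ-homo-+ (+ 3 / 1) (ℚ.- ε)) (ℚᵘ.+-congʳ (mkℚᵘ (+ 3) 0) (ℚᵘ.≃-trans (ℚ.toℚᵘ-homo‿- ε) (ℚᵘ.≃-reflexive (cong ℚᵘ.-_ ε≡)))))
            (ℚᵘ.<-respˡ-≃ (ℚ.toℚᵘ-fromℚᵘ (mkℚᵘ (+ a) d)) (ℚ.toℚᵘ-mono-< lt))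
  cross : + a ℤ.* + suc r ℤ.< (+ 3 ℤ.* + suc r ℤ.+ (ℤ.- + suc p) ℤ.* + 1) ℤ.* + suc d
  cross = subst (λ t → + a ℤ.* + t ℤ.< (+ 3 ℤ.* + suc r ℤ.+ (ℤ.- + suc p) ℤ.* + 1) ℤ.* + suc d) (*-identityˡ (suc r)) (ℚᵘ.drop-*<* in-ℚᵘ)
  rearrange : ∀ s q e → (+ 3 ℤ.* s ℤ.+ (ℤ.- q) ℤ.* + 1) ℤ.* e ℤ.+ q ℤ.* e ≡ + 3 ℤ.* s ℤ.* e
  rearrange = ℤSolver.solve-∀
  in-ℤ : + (a * suc r + suc p * suc d) ℤ.< + (3 * suc r * suc d)
  in-ℤ = subst₂ ℤ._<_
    (trans (cong₂ ℤ._+_ (sym (ℤ.pos-* a (suc r))) (sym (ℤ.pos-* (suc p) (suc d)))) (sym (ℤ.pos-+ (a * suc r) (suc p * suc d))))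
    (trans (rearrange (+ suc r) (+ suc p) (+ suc d)) (trans (cong (ℤ._* + suc d) (sym (ℤ.pos-* 3 (suc r)))) (sym (ℤ.pos-* (3 * suc r) (suc d)))))
    (ℤ.+-monoˡ-< (+ suc p ℤ.* + suc d) cross)

-- Maximum degree and the lower bound

≤maxF : ∀ {n} (f : Fin n → ℕ) i → f i ≤ maxF f
≤maxF f zero    = m≤m⊔n _ _
≤maxF f (suc i) = ≤-trans (≤maxF (f ∘ suc) i) (m≤n⊔m (f zero) _)

maxF-attained : ∀ {n} (f : Fin n → ℕ) {j} → j < maxF f → ∃ λ i → j < f i
maxF-attained {suc n} f {j} lt with ≤-total (f zero) (maxF (f ∘ suc))
... | inj₁ le = map suc id (maxF-attained (f ∘ suc) (subst (j <_) (m≤n⇒m⊔n≡n le) lt))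
... | inj₂ ge = zero , subst (j <_) (m≥n⇒m⊔n≡m ge) lt

-- If every list is `upTo j`, the more than `j` neighbours of a suitable vertex would need distinct
-- colours.
not-choosable : ∀ G j → j < maxDegree G → ¬ InjChoosable G j
not-choosable G j j<Δ choosable with maxF-attained (degree G) j<Δ | choosable (λ _ → upTo j) (λ _ → Unique.upTo⁺ j , length-upTo j)
... | v , j<deg | c , c∈ , inj = <⇒≱ j<deg (begin
  degree G v                   ≡⟨ card≡# (adj G v) ⟩
  # (λ u → adj G v u Bool.≟ true)   ≤⟨ #-injective (λ u → adj G v u Bool.≟ true) {λ _ → ⊤} (λ _ → yes tt) colour (λ _ _ → tt) injective ⟩
  # {j} {λ _ → ⊤} (λ _ → yes tt)    ≤⟨ #≤n {j} {λ _ → ⊤} (λ _ → yes tt) ⟩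
  j                            ∎)
  where
  open ≤-Reasoning
  colour : Fin (order G) → Fin j
  colour u = F.fromℕ< (∈-upTo⁻ (c∈ u))
  injective : ∀ u u′ → adj G v u ≡ true → adj G v u′ ≡ true → colour u ≡ colour u′ → u ≡ u′
  injective u u′ vu vu′ eq = decidable-stable (u F.≟ u′) λ u≢u′ →
    inj u u′ v u≢u′ (trans (adj-sym G u v) vu) (trans (adj-sym G u′ v) vu′)
      (trans (sym (F.toℕ-fromℕ< _)) (trans (cong toℕ eq) (F.toℕ-fromℕ< _)))

-- Sparsity of subgraphs and the induction on edges

module _ (G : Graph) (ε : ℚ) (p r : ℕ) (ε≡ : toℚᵘ ε ≡ mkℚᵘ (+ suc p) r) (mad : MadBelow G ((+ 3 / 1) - ε)) where

  module Sparse (e : Fin (order G) → Fin (order G) → Bool) (e-sym : ∀ u v → e u v ≡ e v u)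
                (e⊆adj : ∀ u v → e u v ≡ true → adj G u v ≡ true) where
    open Edges e e-sym r

    nonIsolated : Fin (order G) → Bool
    nonIsolated v = does (NonIsolated? v)

    -- Deleting edges may isolate vertices; leaving them out matches the vertex count in `dense`.
    sub : Subgraph G
    sub = record
      { vert = nonIsolated ; edge = e ; esym = e-sym ; eadj = e⊆adj
      ; evertˡ = λ u v uv → dec-true (NonIsolated? u) (#-pos (adj? u) v uv) }

    nVert-sub : nVert sub ≡ # NonIsolated?
    nVert-sub = trans (card≡# nonIsolated) (#-cong (λ v → nonIsolated v Bool.≟ true) NonIsolated?
      (λ v → witness (NonIsolated? v)) (λ v → dec-true (NonIsolated? v)))
      where
      witness : {P : Set} (d : Dec P) → does d ≡ true → P
      witness (yes x) _ = x

    -- Every edge is counted once from its smaller and once from its larger end.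
    nEdge-sub : 2 * nEdge sub ≡ sumF deg
    nEdge-sub = begin
      2 * nEdge sub                                     ≡⟨ cong (λ t → nEdge sub + t) (+-identityʳ (nEdge sub)) ⟩
      nEdge sub + nEdge sub                             ≡⟨ cong₂ _+_ up (trans up (sumF-swap (λ u v → χ (up? u v)))) ⟩
      sumF (λ u → # (up? u)) + sumF (λ v → # (λ u → up? u v)) ≡⟨ sumF-+ (λ u → # (up? u)) (λ v → # (λ u → up? u v)) ⟨
      sumF (λ u → # (up? u) + # (λ v → up? v u))        ≡⟨ sumF-cong (λ u → sym (sumF-+ (χ ∘ up? u) (λ v → χ (up? v u)))) ⟩
      sumF (λ u → sumF (λ v → χ (up? u v) + χ (up? v u))) ≡⟨ sumF-cong (λ u → sumF-cong (λ v → ends u v)) ⟩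
      sumF deg                                          ∎
      where
      open ≡-Reasoning
      up? : ∀ u v → Dec (Adj u v × toℕ u < toℕ v)
      up? u v = adj? u v ×-dec (toℕ u <? toℕ v)
      up : nEdge sub ≡ sumF (λ u → # (up? u))
      up = sumF-cong (λ u → trans (card≡# (λ v → e u v ∧ (toℕ u <ᵇ toℕ v))) (#-cong (λ v → (e u v ∧ (toℕ u <ᵇ toℕ v)) Bool.≟ true) (up? u) (λ v → to u v) (λ v → from u v)))
        where
        to : ∀ u v → (e u v ∧ (toℕ u <ᵇ toℕ v)) ≡ true → Adj u v × toℕ u < toℕ v
        to u v h with e u v
        ... | true = refl , <ᵇ⇒< (toℕ u) (toℕ v) (subst T (sym h) tt)
        from : ∀ u v → Adj u v × toℕ u < toℕ v → (e u v ∧ (toℕ u <ᵇ toℕ v)) ≡ true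
        from u v (uv , lt) rewrite uv = Bool.T-≡ .Equivalence.to (<⇒<ᵇ lt)
      ends : ∀ u v → χ (up? u v) + χ (up? v u) ≡ χ (adj? u v)
      ends u v = ≤-antisym (χ-disjoint (up? u v) (up? v u) (adj? u v) proj₁ (Adj-sym ∘ proj₁) (λ { (_ , lt) (_ , gt) → <-asym lt gt }))
                           (χ-union (adj? u v) (up? u v) (up? v u) orient)
        where
        orient : Adj u v → (Adj u v × toℕ u < toℕ v) ⊎ (Adj v u × toℕ v < toℕ u)
        orient uv with <-cmp (toℕ u) (toℕ v)
        ... | tri< lt _ _ = inj₁ (uv , lt)
        ... | tri> _ _ gt = inj₂ (Adj-sym uv , gt)
        ... | tri≈ _ eq _ with F.toℕ-injective eq
        ...   | refl with trans (sym (e⊆adj u u uv)) (irrefl G u)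
        ...     | ()

    sparse : ∀ {u v} → Adj u v → suc r * sumF deg < (2 + 3 * r) * # NonIsolated?
    sparse {u} {v} uv = subst₂ (λ x y → suc r * x < (2 + 3 * r) * y) nEdge-sub nVert-sub (below (nVert sub) refl pos)
      where
      pos : 1 ≤ nVert sub
      pos = ≤-trans (#-pos NonIsolated? u (#-pos (adj? u) v uv)) (≤-reflexive (sym nVert-sub))
      below : ∀ x → nVert sub ≡ x → 1 ≤ x → suc r * (2 * nEdge sub) < (2 + 3 * r) * nVert sub
      below (suc d) eq _ = subst (λ x → suc r * (2 * nEdge sub) < (2 + 3 * r) * x) (sym eq)
        (ratio-below (2 * nEdge sub) d ε p r ε≡ (subst (λ x → ratio (2 * nEdge sub) x <ℚ _) eq (mad sub pos)))

  module _ (Δ-large : threshold r ≤ maxDegree G) (L : Fin (order G) → List ℕ)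
           (L-ok : ∀ v → Unique (L v) × length (L v) ≡ maxDegree G) where

    private
      Δ = maxDegree G
      L-unique : ∀ v → Unique (L v)
      L-unique = proj₁ ∘ L-ok
      L-length : ∀ v → length (L v) ≡ Δ
      L-length = proj₂ ∘ L-ok

    module Step (e : Fin (order G) → Fin (order G) → Bool) (e-sym : ∀ u v → e u v ≡ e v u)
                (e⊆adj : ∀ u v → e u v ≡ true → adj G u v ≡ true) where

      open Edges e e-sym r
      open Reduction e e-sym r Δ L L-unique L-length

      deg≤Δ : ∀ v → deg v ≤ Δ
      deg≤Δ v = ≤-trans (≤-trans (#-mono (adj? v) (λ u → adj G v u Bool.≟ true) (e⊆adj v)) (≤-reflexive (sym (card≡# (adj G v)))))
                        (≤maxF (degree G) v)

      -- Without light edges, a balanced assignment would make the graph too dense, so there is a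
      -- saturated set of payers.
      reducible : ∀ {u v} → Adj u v → Reducible
      reducible uv with F.any? (λ u → F.any? (light? u))
      ... | yes (_ , _ , light) = light-reducible light
      ... | no ¬light with assignment payer
      ...   | inj₂ sat = Core.core-reducible e e-sym r Δ L L-unique L-length deg≤Δ Δ-large (λ u w l → ¬light (u , w , l)) sat
      ...   | inj₁ (f , _ , bounded) = ⊥-elim (<⇒≱ (Sparse.sparse e e-sym e⊆adj uv)
                (Discharging.dense (noLight⇒noLeaves deg≤Δ Δ-large (λ u w l → ¬light (u , w , l))) f bounded))

    Colourable : (e : Fin (order G) → Fin (order G) → Bool) → (∀ u v → e u v ≡ e v u) → Set
    Colourable e e-sym = Σ (Fin (order G) → ℕ) λ c → (∀ v → c v ∈ L v) × (∀ a b → Edges.Conf e e-sym r a b → c a ≢ c b)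

    -- Induction on the degree sum. The lists keep the size Δ of the whole graph, and both `deg≤Δ`
    -- and sparsity pass to the smaller graphs because they are subgraphs.
    colourable : ∀ m e e-sym → (∀ u v → e u v ≡ true → adj G u v ≡ true) → sumF (Edges.deg e e-sym r) < m → Colourable e e-sym
    colourable (suc m) e e-sym e⊆adj (s≤s small) with F.any? (λ u → F.any? (λ v → e u v Bool.≟ true))
    ... | no ¬edge = (λ v → proj₁ (first v)) , (λ v → proj₂ (first v)) , λ { a b (_ , x , ax , _) → ⊥-elim (¬edge (a , x , ax)) }
      where
      first : ∀ v → ∃ (_∈ L v)
      first v = nonempty (L v) (≤-trans (≤-trans (s≤s z≤n) Δ-large) (≤-reflexive (sym (L-length v))))
    ... | yes (_ , _ , edge) with Step.reducible e e-sym e⊆adj edge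
    ...   | u , w , uw , extend =
      let c , c∈ , proper = colourable m delete delete-sym (λ a b → e⊆adj a b ∘ delete⁻ a b) (<-≤-trans fewer small)
      in extend c c∈ (λ { a b (a≢b , x , (ax , ¬cut) , (bx , ¬cut′)) → proper a b (a≢b , x , delete⁺ ax ¬cut , delete⁺ bx ¬cut′) })
      where
      open Delete e e-sym u w
      open module E = Edges e e-sym r using (adj?; deg)
      open module D = Edges delete delete-sym r using () renaming (adj? to adj⁻?; deg to deg⁻)
      fewer : sumF deg⁻ < sumF deg
      fewer = sumF-strict (λ a → #-mono (adj⁻? a) (adj? a) (delete⁻ a)) u (#-strict (adj⁻? u) (adj? u) (delete⁻ u) w uw delete-cut)

  choosable : threshold r ≤ maxDegree G → InjChoosable G (maxDegree G)
  choosable Δ-large L L-ok =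
    let c , c∈ , proper = colourable Δ-large L L-ok _ (adj G) (adj-sym G) (λ _ _ → id) ≤-refl
    in c , c∈ , λ u v w u≢v uw vw → proper u v (u≢v , w , uw , vw)

theorem3 : Σ (ℚ → ℕ) (λ f → ∀ (ε : ℚ) → 0ℚ <ℚ ε → ∀ (G : Graph) → MadBelow G ((+ 3 / 1) - ε) → f ε ≤ maxDegree G → ListInjChromNumIs G (maxDegree G))
-- In lowest terms a positive ε is (p + 1) / (r + 1), and `denominator-1` is this r. The last two
-- clauses contradict positivity.
theorem3 = threshold ∘ ℚ.denominator-1 , λ
  { ε@(mkℚ (+ suc p) r cop) _ G mad large → choosable G ε p r refl mad large , not-choosable G
  ; (mkℚ (+ zero) r cop) (ℚ.*<* (ℤ.+<+ ()))
  ; (mkℚ (-[1+ p ]) r cop) (ℚ.*<* ()) }
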